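{- There exists a real number that is regainingly approximable and nearly computable but not computable.
   Context: A real $x$ is computable if there is a computable sequence of rationals $(x_n)_n$ with $|x-x_n|<2^{ -n}$ for all $n$. A real $x$ is regainingly approximable if there is a computable non-decreasing sequence of rationals $(x_n)_n$ converging to $x$ with $x - x_n < 2^{ -n}$ for infinitely many $n\in\mathbb{N}$. A function $f:\mathbb{N}\to\mathbb{N}$ is a modulus of convergence of a convergent sequence $(y_n)_n$ with limit $y$ if for all $n$ and all $m\ge f(n)$ we have $|y-y_m|<2^{ -n}$; $(y_n)_n$ converges computably if it has a computable modulus of convergence. A sequence $(x_n)_n$ converges nearly computably if it converges and for every computable increasing function $s:\mathbb{N}\to\mathbb{N}$ the sequence $(x_{s(n+1)}-x_{s(n)})_n$ converges computably to $0$. A real is nearly computable if some computable sequence of rationals converges nearly computably to it. -}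

module Defs where

open import Data.Fin.Base using (Fin)
open import Data.Integer.Base as ℤ using (_⊖_)
open import Data.Nat.Base as ℕ using (ℕ; zero; suc)
open import Data.Nat.Properties using (m^n≢0)
open import Data.Product.Base using (Σ; ∃; _×_; _,_)
open import Data.Rational.Base as ℚ using (ℚ; 0ℚ; 1ℚ; _/_; _+_; _-_; _<_; _≤_)
open import Data.Rational.Properties
  using (_<?_; <-trans; <-asym; <-cmp; <-dense; +-monoʳ-<; +-identityʳ)
open import Data.Sum.Base using (_⊎_; inj₁; inj₂)
open import Data.Vec.Base using (Vec; []; _∷_; lookup)
open import Data.Vec.Relation.Binary.Pointwise.Inductive using (Pointwise)
open import Function.Bundles using (_⇔_; mk⇔)
open import Level using (0ℓ)
open import Relation.Binary.Definitions using (Monotonic₁; tri<; tri≈; tri>)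
open import Relation.Binary.PropositionalEquality using (_≡_; refl; subst)
open import Relation.Nullary.Negation using (¬_)
open import Relation.Nullary.Decidable using (toWitness)
open import Relation.Unary using (Pred; Satisfiable)

-- Codes for Kleene's n-ary μ-recursive partial functions.

data Rec : ℕ → Set where
  zer  : Rec 0
  succ : Rec 1
  proj : ∀ {n} → Fin n → Rec n
  comp : ∀ {m n} → Rec m → Vec (Rec n) m → Rec n
  prec : ∀ {n} → Rec n → Rec (suc (suc n)) → Rec (suc n)
  mu   : ∀ {n} → Rec (suc n) → Rec n

infix 4 _[_]⇓_

-- c [ xs ]⇓ y : the partial function denoted by c is defined at xs, with
-- value y.  The recursion variable of prec and the search variable of mu
-- come first; the step function of prec receives the predecessor, then the
-- previous value, then the parameters.

data _[_]⇓_ : ∀ {n} → Rec n → Vec ℕ n → ℕ → Set where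
  ⇓zer  : zer [ [] ]⇓ 0
  ⇓succ : ∀ {x} → succ [ x ∷ [] ]⇓ suc x
  ⇓proj : ∀ {n} {i : Fin n} {xs} → proj i [ xs ]⇓ lookup xs i
  ⇓comp : ∀ {m n} {f : Rec m} {gs : Vec (Rec n) m} {xs ys z} →
          Pointwise (λ g y → g [ xs ]⇓ y) gs ys →
          f [ ys ]⇓ z →
          comp f gs [ xs ]⇓ z
  ⇓prec-zero : ∀ {n} {g : Rec n} {h xs y} →
               g [ xs ]⇓ y →
               prec g h [ zero ∷ xs ]⇓ y
  ⇓prec-suc  : ∀ {n} {g : Rec n} {h xs k r y} →
               prec g h [ k ∷ xs ]⇓ r →
               h [ k ∷ r ∷ xs ]⇓ y →
               prec g h [ suc k ∷ xs ]⇓ y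
  ⇓mu   : ∀ {n} {f : Rec (suc n)} {xs y} →
          f [ y ∷ xs ]⇓ 0 →
          (∀ i → i ℕ.< y → ∃ λ k → f [ i ∷ xs ]⇓ suc k) →
          mu f [ xs ]⇓ y

ComputableFun : (ℕ → ℕ) → Set
ComputableFun f = Σ (Rec 1) λ c → ∀ n → c [ n ∷ [] ]⇓ f n

-- A sequence of rationals is computable if it can be written as
-- (a n - b n) / (d n + 1) with computable a, b, d : ℕ → ℕ.

ComputableSeq : (ℕ → ℚ) → Set
ComputableSeq x =
  ∃ λ a → ∃ λ b → ∃ λ d →
    ComputableFun a × ComputableFun b × ComputableFun d ×
    (∀ n → x n ≡ (a n ⊖ b n) / suc (d n))

-- Two-sided Dedekind cuts.

record ℝ : Set₁ where
  field
    lower upper   : Pred ℚ 0ℓ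
    lower-inhabited : Satisfiable lower
    upper-inhabited : Satisfiable upper
    lower-rounded : ∀ q → lower q ⇔ ∃ λ r → q < r × lower r
    upper-rounded : ∀ q → upper q ⇔ ∃ λ r → r < q × upper r
    disjoint      : ∀ q → ¬ (lower q × upper q)
    located       : ∀ q r → q < r → lower q ⊎ upper r

infix 4 _<ˡ_ _<ʳ_

_<ˡ_ : ℚ → ℝ → Set
q <ˡ x = ℝ.lower x q

_<ʳ_ : ℝ → ℚ → Set
x <ʳ q = ℝ.upper x q

-- |x - q| < ε
Within : ℝ → ℚ → ℚ → Set
Within x q ε = (q - ε <ˡ x) × (x <ʳ q + ε)

fromℚ : ℚ → ℝ
fromℚ p = record
  { lower           = _< p
  ; upper           = p <_
  ; lower-inhabited = p - 1ℚ , p-1<p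
  ; upper-inhabited = p + 1ℚ , p<p+1
  ; lower-rounded   = λ q → mk⇔ (λ q<p → let m , q<m , m<p = <-dense q<p in m , q<m , m<p)
                                (λ (r , q<r , r<p) → <-trans q<r r<p)
  ; upper-rounded   = λ q → mk⇔ (λ p<q → let m , p<m , m<q = <-dense p<q in m , m<q , p<m)
                                (λ (r , r<q , p<r) → <-trans p<r r<q)
  ; disjoint        = λ q (q<p , p<q) → <-asym q<p p<q
  ; located         = locate
  }
  where
  p-1<p : p - 1ℚ < p
  p-1<p = subst (p - 1ℚ <_) (+-identityʳ p)
            (+-monoʳ-< p (toWitness {a? = (ℚ.- 1ℚ) <? 0ℚ} _))

  p<p+1 : p < p + 1ℚ
  p<p+1 = subst (_< p + 1ℚ) (+-identityʳ p)
            (+-monoʳ-< p (toWitness {a? = 0ℚ <? 1ℚ} _))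

  locate : ∀ q r → q < r → q < p ⊎ p < r
  locate q r q<r with <-cmp q p
  ... | tri< q<p _ _    = inj₁ q<p
  ... | tri≈ _ refl _   = inj₂ q<r
  ... | tri> _ _ p<q    = inj₂ (<-trans p<q q<r)

2^-_ : ℕ → ℚ
2^- n = _/_ (ℤ.+ 1) (2 ℕ.^ n) {{m^n≢0 2 n}}

_ConvergesTo_ : (ℕ → ℚ) → ℝ → Set
y ConvergesTo l =
  ∀ ε → 0ℚ < ε → ∃ λ N → ∀ m → N ℕ.≤ m → Within l (y m) ε

IsModulus : (ℕ → ℕ) → (ℕ → ℚ) → ℝ → Set
IsModulus f y l = ∀ n m → f n ℕ.≤ m → Within l (y m) (2^- n)

_ConvergesComputablyTo_ : (ℕ → ℚ) → ℝ → Set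
y ConvergesComputablyTo l =
  y ConvergesTo l × ∃ λ f → ComputableFun f × IsModulus f y l

_ConvergesNearlyComputablyTo_ : (ℕ → ℚ) → ℝ → Set
y ConvergesNearlyComputablyTo l =
  y ConvergesTo l ×
  (∀ s → ComputableFun s → Monotonic₁ ℕ._<_ ℕ._<_ s →
     (λ n → y (s (suc n)) - y (s n)) ConvergesComputablyTo fromℚ 0ℚ)

Computable : ℝ → Set
Computable x =
  ∃ λ xs → ComputableSeq xs × (∀ n → Within x (xs n) (2^- n))

InfinitelyMany : Pred ℕ 0ℓ → Set
InfinitelyMany P = ∀ m → ∃ λ n → m ℕ.≤ n × P n

-- x <ʳ xs n + 2^- n says x - xs n < 2⁻ⁿ.
RegaininglyApproximable : ℝ → Set
RegaininglyApproximable x =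
  ∃ λ xs → ComputableSeq xs × Monotonic₁ ℕ._≤_ _≤_ xs × xs ConvergesTo x ×
    InfinitelyMany (λ n → x <ʳ xs n + 2^- n)

NearlyComputable : ℝ → Set
NearlyComputable x =
  ∃ λ xs → ComputableSeq xs × xs ConvergesNearlyComputablyTo x

{-# OPTIONS --safe #-}

-- A left-computable real is built by a tree construction.  A node of level e
-- created at stage w watches the e-th program.  As a candidate modulus f of
-- the approximation, the program is refuted once f (w + 2) has converged: the
-- node then requests an increment of 2^-(w + 2).  As a candidate subsequence
-- s, it forces the increments from below to be sliced: the subtree under the
-- guess that s is total advances only when s has a value after the last
-- advance, and each increment 2^-k that it issues at stage q is emitted in 2^q
-- pieces, one per advance.  The subtree under the opposite guess is discarded
-- at every advance.  Slicing happens at every level on the path to the root,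
-- so a pending slice at level e only waits for programs of level ≤ e.
--
-- The nodes created after stage t request less than 2^-(t + 1) in total.  Hence
-- the stage at which the final node of a level on the true path is created
-- regains the approximation; the request of that node, once passed on to the
-- root, refutes its program as a modulus; and if s is total, then a window of s
-- contains one advance, hence boundedly many pieces of computably small size,
-- besides requests of nodes created after the last advance.

module Submission where

open import Defs
open import Axiom.ExcludedMiddle using (ExcludedMiddle)
open import Data.Bool.Base using (Bool; true; false; if_then_else_; not; _∧_; T)
open import Data.Empty using (⊥)
open import Data.Fin.Base using (Fin; zero; suc)
open import Data.Integer.Base as ℤ using (_⊖_)
import Data.Integer.Properties as ℤ
open import Data.List.Base using (List; []; _∷_; _++_)
open import Data.Maybe.Base using (Maybe; just; nothing)
open import Data.Nat.Base as ℕ using (ℕ; zero; suc; z≤n; s≤s; s≤s⁻¹; NonZero; pred)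
import Data.Nat.Properties as ℕ
open import Data.Product.Base using (∃; _×_; _,_; proj₁; proj₂; map₂)
open import Data.Sum.Base using (_⊎_; inj₁; inj₂; [_,_]′)
open import Data.Unit.Base using (⊤; tt)
open import Data.Vec.Base using (Vec; []; _∷_; lookup)
open import Data.Vec.Relation.Binary.Pointwise.Inductive using (Pointwise; []; _∷_)
open import Function.Base using (_∘_; id; _$_)
open import Function.Bundles using (mk⇔)
open import Level using (0ℓ)
open import Relation.Binary.Definitions using (Monotonic₁)
open import Relation.Binary.PropositionalEquality
  using (_≡_; refl; sym; trans; cong; cong₂; subst; subst₂; module ≡-Reasoning)
open import Relation.Nullary.Decidable using (yes; no; dec⇒maybe)
open import Relation.Nullary.Negation using (¬_; contradiction)
open import Tactic.RingSolver using (solve-∀)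
open import Tactic.RingSolver.Core.AlmostCommutativeRing using (AlmostCommutativeRing; fromCommutativeRing)

-- The two demands conflict: refuting a modulus needs a jump of prescribed size, while near
-- computability wants all jumps along a total subsequence to be small from a computable point on.
-- Cutting an increment that arrives at stage q into 2^q pieces reconciles them whatever its size,
-- since a piece is at most 2^-q and q can be read off the tree.
--
-- The delay must not spoil regaining or the refutation. Hence the subtree under the infinite guess
-- is visited only when the queue of pieces is empty. A visit to a node thus finds no piece waiting
-- at any infinite guess on its path, and it wipes out the opposite subtrees there. On a path that
-- is never discarded again, every visit restarts the accounts: what was issued at an earlier visit
-- has reached the root, and nothing older remains to be paid except from the node itself and its
-- subtrees.
--
-- The exponent w + 2 is what this allows. At most one node is created per stage, so a node created
-- at stage w and all later ones together request at most 2^-(w + 1), strictly below the 2^-w that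
-- regaining demands.

module Computability where
  open import Data.Nat.Base using (_+_; _*_; _∸_; _^_; _≤_; _<_; _≤ᵇ_)
  open import Data.Nat.Properties

  -- Recursive functions on natural numbers

  ⇓-resp : ∀ {n} {c : Rec n} {xs y z} → y ≡ z → c [ xs ]⇓ y → c [ xs ]⇓ z
  ⇓-resp refl p = p

  ⇓comp₁ : ∀ {n} {f : Rec 1} {g : Rec n} {xs y z} →
           g [ xs ]⇓ y → f [ y ∷ [] ]⇓ z → comp f (g ∷ []) [ xs ]⇓ z
  ⇓comp₁ p q = ⇓comp (p ∷ []) q

  ⇓comp₂ : ∀ {n} {f : Rec 2} {g h : Rec n} {xs x y z} →
           g [ xs ]⇓ x → h [ xs ]⇓ y → f [ x ∷ y ∷ [] ]⇓ z →
           comp f (g ∷ h ∷ []) [ xs ]⇓ z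
  ⇓comp₂ p q r = ⇓comp (p ∷ q ∷ []) r

  ⇓prec : ∀ {n} {g : Rec n} {h xs} (F : ℕ → ℕ) → g [ xs ]⇓ F 0 →
          (∀ k → h [ k ∷ F k ∷ xs ]⇓ F (suc k)) → ∀ k → prec g h [ k ∷ xs ]⇓ F k
  ⇓prec F p q zero    = ⇓prec-zero p
  ⇓prec F p q (suc k) = ⇓prec-suc (⇓prec F p q k) (q k)

  pattern 0F = zero
  pattern 1F = suc zero
  pattern 2F = suc (suc zero)

  zeroR : ∀ {n} → Rec n
  zeroR = comp zer []

  ⇓zero : ∀ {n} {xs : Vec ℕ n} → zeroR [ xs ]⇓ 0
  ⇓zero = ⇓comp [] ⇓zer

  constR : ∀ {n} → ℕ → Rec n
  constR zero    = zeroR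
  constR (suc k) = comp succ (constR k ∷ [])

  ⇓const : ∀ {n} {xs : Vec ℕ n} k → constR k [ xs ]⇓ k
  ⇓const zero    = ⇓zero
  ⇓const (suc k) = ⇓comp₁ (⇓const k) ⇓succ

  addR mulR monusR : Rec 2
  addR   = prec (proj 0F) (comp succ (proj 1F ∷ []))
  mulR   = prec zeroR (comp addR (proj 2F ∷ proj 1F ∷ []))

  predR : Rec 1
  predR = prec zer (proj 0F)

  monusR = comp (prec (proj 0F) (comp predR (proj 1F ∷ []))) (proj 1F ∷ proj 0F ∷ [])

  ⇓add : ∀ {m n} → addR [ m ∷ n ∷ [] ]⇓ m + n
  ⇓add {m} {n} = ⇓prec (_+ n) ⇓proj (λ _ → ⇓comp₁ ⇓proj ⇓succ) m

  ⇓mul : ∀ {m n} → mulR [ m ∷ n ∷ [] ]⇓ m * n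
  ⇓mul {m} {n} = ⇓prec (_* n) ⇓zero (λ _ → ⇓comp₂ ⇓proj ⇓proj ⇓add) m

  ⇓pred : ∀ {n} → predR [ n ∷ [] ]⇓ pred n
  ⇓pred {n} = ⇓prec pred ⇓zer (λ _ → ⇓proj) n

  ⇓monus : ∀ {m n} → monusR [ m ∷ n ∷ [] ]⇓ m ∸ n
  ⇓monus {m} {n} = ⇓comp₂ ⇓proj ⇓proj (⇓prec (m ∸_) ⇓proj
    (λ k → ⇓-resp (pred[m∸n]≡m∸[1+n] m k) (⇓comp₁ ⇓proj ⇓pred)) n)

  least : (g : ℕ → ℕ) → ∀ n → g n ≡ 0 →
          ∃ λ m → g m ≡ 0 × (∀ i → i < m → ∃ λ k → g i ≡ suc k)
  least g n gn≡0 with g 0 in eq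
  least g n       gn≡0 | zero  = 0 , eq , λ _ ()
  least g zero    gn≡0 | suc k = contradiction (trans (sym gn≡0) eq) λ ()
  least g (suc n) gn≡0 | suc k with m , gm≡0 , below ← least (g ∘ suc) n gn≡0 =
    suc m , gm≡0 , λ { zero _ → k , eq ; (suc i) (s≤s i<m) → below i i<m }

  ⇓least : ∀ {n} {f : Rec (suc n)} {xs} (g : ℕ → ℕ) → (∀ i → f [ i ∷ xs ]⇓ g i) →
           ∀ {n} (gn≡0 : g n ≡ 0) → mu f [ xs ]⇓ proj₁ (least g n gn≡0)
  ⇓least {f = f} {xs} g p {n} gn≡0 with m , gm≡0 , below ← least g n gn≡0 =
    ⇓mu (⇓-resp gm≡0 (p m))
        (λ i i<m → map₂ (λ eq → ⇓-resp eq (p i)) (below i i<m))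

  -- A pairing function

  -- It vanishes exactly when n < (r + 1)², so its least zero in r is the integer square root of n,
  -- in the form that `mu` can find.
  sqrtGap : ℕ → ℕ → ℕ
  sqrtGap n r = suc n ∸ suc r * suc r

  sqrtGap-zero : ∀ n → sqrtGap n n ≡ 0
  sqrtGap-zero n = m≤n⇒m∸n≡0 (m≤m*n (suc n) (suc n))

  sqrtGap-unique : ∀ {n r} s → s * s ≤ n → n < suc s * suc s →
                   sqrtGap n r ≡ 0 → (∀ i → i < r → ∃ λ k → sqrtGap n i ≡ suc k) → r ≡ s
  sqrtGap-unique {n} {r} s s²≤n n<[1+s]² gap≡0 below = ≤-antisym (≮⇒≥ s≮r) (≮⇒≥ r≮s)
    where
    s≮r : ¬ s < r
    s≮r s<r = contradiction (trans (sym (proj₂ (below s s<r))) (m≤n⇒m∸n≡0 n<[1+s]²)) λ ()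
    r≮s : ¬ r < s
    r≮s r<s = <⇒≱ (m∸n≡0⇒m≤n {suc n} gap≡0) (≤-trans (*-mono-≤ r<s r<s) s²≤n)

  opaque
    -- As a ≤ a + b, the value lies in the interval from (a + b)² up to (a + b + 1)²; its integer
    -- square root therefore returns a + b, and the remainder returns a.
    pair : ℕ → ℕ → ℕ
    pair a b = (a + b) * (a + b) + a

    ⌊√_⌋ : ℕ → ℕ
    ⌊√ n ⌋ = proj₁ (least (sqrtGap n) n (sqrtGap-zero n))

    π₁ π₂ : ℕ → ℕ
    π₁ n = n ∸ ⌊√ n ⌋ * ⌊√ n ⌋
    π₂ n = ⌊√ n ⌋ ∸ π₁ n

    pair-upper : ∀ a b → pair a b < suc (a + b) * suc (a + b)
    pair-upper a b = s≤s (begin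
      (a + b) * (a + b) + a              ≤⟨ +-monoʳ-≤ ((a + b) * (a + b)) (m≤m+n a b) ⟩
      (a + b) * (a + b) + (a + b)        ≡⟨ +-comm ((a + b) * (a + b)) (a + b) ⟩
      (a + b) + (a + b) * (a + b)        ≡⟨ *-suc (a + b) (a + b) ⟨
      (a + b) * suc (a + b)              ≤⟨ m≤n+m ((a + b) * suc (a + b)) (a + b) ⟩
      (a + b) + (a + b) * suc (a + b)    ∎)
      where open ≤-Reasoning

    ⌊√pair⌋ : ∀ a b → ⌊√ pair a b ⌋ ≡ a + b
    ⌊√pair⌋ a b =
      sqrtGap-unique (a + b) (m≤m+n ((a + b) * (a + b)) a) (pair-upper a b) (proj₁ (proj₂ l)) (proj₂ (proj₂ l))
      where
      l : ∃ λ m → sqrtGap (pair a b) m ≡ 0 × (∀ i → i < m → ∃ λ k → sqrtGap (pair a b) i ≡ suc k)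
      l = least (sqrtGap (pair a b)) (pair a b) (sqrtGap-zero (pair a b))

    π₁-pair : ∀ a b → π₁ (pair a b) ≡ a
    π₁-pair a b = trans (cong (λ r → pair a b ∸ r * r) (⌊√pair⌋ a b)) (m+n∸m≡n ((a + b) * (a + b)) a)

    π₂-pair : ∀ a b → π₂ (pair a b) ≡ b
    π₂-pair a b = trans (cong₂ _∸_ (⌊√pair⌋ a b) (π₁-pair a b)) (m+n∸m≡n a b)

    pairR : Rec 2
    pairR = comp addR (comp mulR (addR ∷ addR ∷ []) ∷ proj 0F ∷ [])

    ⇓pair : ∀ {a b} → pairR [ a ∷ b ∷ [] ]⇓ pair a b
    ⇓pair = ⇓comp₂ (⇓comp₂ ⇓add ⇓add ⇓mul) ⇓proj ⇓add

    sqrtR : Rec 1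
    sqrtR = mu (comp monusR (comp succ (proj 1F ∷ []) ∷
                             comp mulR (comp succ (proj 0F ∷ []) ∷ comp succ (proj 0F ∷ []) ∷ []) ∷ []))

    ⇓sqrt : ∀ {n} → sqrtR [ n ∷ [] ]⇓ ⌊√ n ⌋
    ⇓sqrt {n} = ⇓least (sqrtGap n)
      (λ i → ⇓comp₂ (⇓comp₁ ⇓proj ⇓succ) (⇓comp₂ (⇓comp₁ ⇓proj ⇓succ) (⇓comp₁ ⇓proj ⇓succ) ⇓mul) ⇓monus)
      (sqrtGap-zero n)

    π₁R π₂R : Rec 1
    π₁R = comp monusR (proj 0F ∷ comp mulR (sqrtR ∷ sqrtR ∷ []) ∷ [])
    π₂R = comp monusR (sqrtR ∷ π₁R ∷ [])

    ⇓π₁ : ∀ {n} → π₁R [ n ∷ [] ]⇓ π₁ n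
    ⇓π₁ = ⇓comp₂ ⇓proj (⇓comp₂ ⇓sqrt ⇓sqrt ⇓mul) ⇓monus

    ⇓π₂ : ∀ {n} → π₂R [ n ∷ [] ]⇓ π₂ n
    ⇓π₂ = ⇓comp₂ ⇓sqrt ⇓π₁ ⇓monus

  ⇓π₁-pair : ∀ {a b} → π₁R [ pair a b ∷ [] ]⇓ a
  ⇓π₁-pair {a} {b} = ⇓-resp (π₁-pair a b) ⇓π₁

  ⇓π₂-pair : ∀ {a b} → π₂R [ pair a b ∷ [] ]⇓ b
  ⇓π₂-pair {a} {b} = ⇓-resp (π₂-pair a b) ⇓π₂

  -- Computable functions between encoded types

  record Encoding (A : Set) : Set where
    field encode : A → ℕ

  open Encoding {{...}} public

  instance
    ℕ-encoding : Encoding ℕ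
    ℕ-encoding .encode n = n

    ⊤-encoding : Encoding ⊤
    ⊤-encoding .encode _ = 0

    ×-encoding : ∀ {A B} {{_ : Encoding A}} {{_ : Encoding B}} → Encoding (A × B)
    ×-encoding .encode (a , b) = pair (encode a) (encode b)

    ⊎-encoding : ∀ {A B} {{_ : Encoding A}} {{_ : Encoding B}} → Encoding (A ⊎ B)
    ⊎-encoding .encode (inj₁ a) = pair 0 (encode a)
    ⊎-encoding .encode (inj₂ b) = pair 1 (encode b)

  record Comp {A B : Set} {{_ : Encoding A}} {{_ : Encoding B}} (f : A → B) : Set where
    constructor _computes_
    field
      code  : Rec 1
      code⇓ : ∀ a → code [ encode a ∷ [] ]⇓ encode (f a)

  module _ {A B : Set} {{_ : Encoding A}} {{_ : Encoding B}} where

    ext : {f g : A → B} → Comp f → (∀ a → f a ≡ g a) → Comp g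
    ext (c computes c⇓) f≗g = c computes λ a → ⇓-resp (cong encode (f≗g a)) (c⇓ a)

    -- Encodings are arranged so that views such as `List-view` and `Tree-view` do not change the
    -- number; the identity code then computes them.
    recode : {f : A → B} → (∀ a → encode a ≡ encode (f a)) → Comp f
    recode eq = proj 0F computes λ a → ⇓-resp (eq a) ⇓proj

    constᶜ : (b : B) → Comp {A} λ _ → b
    constᶜ b = constR (encode b) computes λ _ → ⇓const (encode b)

    fstᶜ : Comp {A × B} proj₁
    fstᶜ = π₁R computes λ _ → ⇓π₁-pair

    sndᶜ : Comp {A × B} proj₂
    sndᶜ = π₂R computes λ _ → ⇓π₂-pair

    inj₁ᶜ : Comp {A} {A ⊎ B} inj₁
    inj₁ᶜ = comp pairR (zeroR ∷ proj 0F ∷ []) computes λ _ → ⇓comp₂ ⇓zero ⇓proj ⇓pair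

    inj₂ᶜ : Comp {B} {A ⊎ B} inj₂
    inj₂ᶜ = comp pairR (constR 1 ∷ proj 0F ∷ []) computes λ _ → ⇓comp₂ (⇓const 1) ⇓proj ⇓pair

  idᶜ : ∀ {A} {{_ : Encoding A}} → Comp {A} id
  idᶜ = recode λ _ → refl

  module _ {A B C : Set} {{_ : Encoding A}} {{_ : Encoding B}} {{_ : Encoding C}} where

    infixr 9 _∘ᶜ_
    _∘ᶜ_ : {g : B → C} {f : A → B} → Comp g → Comp f → Comp (g ∘ f)
    _∘ᶜ_ {f = f} (d computes d⇓) (c computes c⇓) = comp d (c ∷ []) computes λ a → ⇓comp₁ (c⇓ a) (d⇓ (f a))

    infixr 4 _,ᶜ_
    _,ᶜ_ : {f : A → B} {g : A → C} → Comp f → Comp g → Comp λ a → f a , g a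
    (c computes c⇓) ,ᶜ (d computes d⇓) = comp pairR (c ∷ d ∷ []) computes λ a → ⇓comp₂ (c⇓ a) (d⇓ a) ⇓pair

  -- Composition in Rec is strict, so a branch is guarded by a recursion that
  -- runs it at most once.
  whenR : Rec 1 → Rec 2
  whenR c = prec zeroR (comp c (proj 2F ∷ []))

  -- The branches are guarded by `1 ∸ tag` and `tag` and then added: the unselected one is never run
  -- and contributes 0.
  caseR : Rec 1 → Rec 1 → Rec 2
  caseR c d = comp addR
    ( comp (whenR c) (comp monusR (constR 1 ∷ proj 0F ∷ []) ∷ proj 1F ∷ [])
    ∷ comp (whenR d) (proj 0F ∷ proj 1F ∷ []) ∷ [])

  ⇓case₀ : ∀ {c d x y} → c [ x ∷ [] ]⇓ y → caseR c d [ 0 ∷ x ∷ [] ]⇓ y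
  ⇓case₀ {y = y} p = ⇓-resp (+-identityʳ y) (⇓comp₂
    (⇓comp₂ (⇓comp₂ (⇓const 1) ⇓proj ⇓monus) ⇓proj (⇓prec-suc (⇓prec-zero ⇓zero) (⇓comp₁ ⇓proj p)))
    (⇓comp₂ ⇓proj ⇓proj (⇓prec-zero ⇓zero)) ⇓add)

  ⇓case₁ : ∀ {c d x y} → d [ x ∷ [] ]⇓ y → caseR c d [ 1 ∷ x ∷ [] ]⇓ y
  ⇓case₁ p = ⇓comp₂
    (⇓comp₂ (⇓comp₂ (⇓const 1) ⇓proj ⇓monus) ⇓proj (⇓prec-zero ⇓zero))
    (⇓comp₂ ⇓proj ⇓proj (⇓prec-suc (⇓prec-zero ⇓zero) (⇓comp₁ ⇓proj p))) ⇓add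

  module _ {A B C D : Set} {{_ : Encoding A}} {{_ : Encoding B}} {{_ : Encoding C}} {{_ : Encoding D}} where

    caseᶜ : {v : A → B ⊎ C} {f : A × B → D} {g : A × C → D} → Comp v → Comp f → Comp g →
            Comp λ a → [ (λ b → f (a , b)) , (λ c → g (a , c)) ]′ (v a)
    caseᶜ {v} {f} {g} (r computes r⇓) (c computes c⇓) (d computes d⇓) = branch computes λ a → branch⇓ a (v a) (r⇓ a)
      where
      branch : Rec 1
      branch = comp (caseR c d) (comp π₁R (r ∷ []) ∷ comp pairR (proj 0F ∷ comp π₂R (r ∷ []) ∷ []) ∷ [])
      branch⇓ : ∀ a w → r [ encode a ∷ [] ]⇓ encode w →
                branch [ encode a ∷ [] ]⇓ encode ([_,_]′ (λ b → f (a , b)) (λ c → g (a , c)) w)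
      branch⇓ a (inj₁ b) p = ⇓comp₂ (⇓comp₁ p ⇓π₁-pair)
        (⇓comp₂ ⇓proj (⇓comp₁ p ⇓π₂-pair) ⇓pair) (⇓case₀ (c⇓ (a , b)))
      branch⇓ a (inj₂ b) p = ⇓comp₂ (⇓comp₁ p ⇓π₁-pair)
        (⇓comp₂ ⇓proj (⇓comp₁ p ⇓π₂-pair) ⇓pair) (⇓case₁ (d⇓ (a , b)))

  natRec : {B : Set} → B → (ℕ → B → B) → ℕ → B
  natRec b s zero    = b
  natRec b s (suc n) = s n (natRec b s n)

  module _ {A B : Set} {{_ : Encoding A}} {{_ : Encoding B}} where

    natRecᶜ : {k : A → ℕ} {f : A → B} {g : A × ℕ × B → B} → Comp k → Comp f → Comp g →
              Comp λ a → natRec (f a) (λ n b → g (a , n , b)) (k a)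
    natRecᶜ {k} {f} {g} (r computes r⇓) (c computes c⇓) (d computes d⇓) =
      comp (prec c (comp d (comp pairR (proj 2F ∷ comp pairR (proj 0F ∷ proj 1F ∷ []) ∷ []) ∷ [])))
           (r ∷ proj 0F ∷ []) computes
      λ a → ⇓comp₂ (r⇓ a) ⇓proj
        (⇓prec (λ n → encode (natRec (f a) (λ n b → g (a , n , b)) n)) (c⇓ a)
          (λ n → ⇓comp₁ (⇓comp₂ ⇓proj (⇓comp₂ ⇓proj ⇓proj ⇓pair) ⇓pair)
            (d⇓ (a , n , natRec (f a) (λ n b → g (a , n , b)) n))) (k a))

  module _ {A : Set} {{_ : Encoding A}} where

    -- The code is a bare unbounded search; `bound` only certifies that it stops. It may therefore
    -- come from a classical existence proof.
    leastᶜ : {g : A × ℕ → ℕ} → Comp g → (bound : ∀ a → ∃ λ n → g (a , n) ≡ 0) →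
             Comp λ a → proj₁ (least (λ n → g (a , n)) (proj₁ (bound a)) (proj₂ (bound a)))
    leastᶜ {g} (c computes c⇓) bound =
      mu (comp c (comp pairR (proj 1F ∷ proj 0F ∷ []) ∷ [])) computes
      λ a → ⇓least (λ n → g (a , n)) (λ n → ⇓comp₁ (⇓comp₂ ⇓proj ⇓proj ⇓pair) (c⇓ (a , n))) (proj₂ (bound a))

    binary : {h : ℕ → ℕ → ℕ} {c : Rec 2} → (∀ {m n} → c [ m ∷ n ∷ [] ]⇓ h m n) →
             {f g : A → ℕ} → Comp f → Comp g → Comp λ a → h (f a) (g a)
    binary {c = c} p (d computes d⇓) (e computes e⇓) = comp c (d ∷ e ∷ []) computes λ a → ⇓comp₂ (d⇓ a) (e⇓ a) p

    infixl 6 _+ᶜ_ _∸ᶜ_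
    infixl 7 _*ᶜ_

    _+ᶜ_ : {f g : A → ℕ} → Comp f → Comp g → Comp λ a → f a + g a
    _+ᶜ_ = binary ⇓add

    _*ᶜ_ : {f g : A → ℕ} → Comp f → Comp g → Comp λ a → f a * g a
    _*ᶜ_ = binary ⇓mul

    _∸ᶜ_ : {f g : A → ℕ} → Comp f → Comp g → Comp λ a → f a ∸ g a
    _∸ᶜ_ = binary ⇓monus

    pairᶜ : {f g : A → ℕ} → Comp f → Comp g → Comp λ a → pair (f a) (g a)
    pairᶜ = binary ⇓pair

    sucᶜ : {f : A → ℕ} → Comp f → Comp λ a → suc (f a)
    sucᶜ p = constᶜ 1 +ᶜ p

  2^ᶜ_ : ∀ {A} {{_ : Encoding A}} {f : A → ℕ} → Comp f → Comp λ a → 2 ^ f a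
  2^ᶜ_ {f = f} p =
    ext (natRecᶜ {g = λ (_ , _ , r) → 2 * r} p (constᶜ 1) (constᶜ 2 *ᶜ (sndᶜ ∘ᶜ sndᶜ))) (λ a → natRec-2^ (f a))
    where
    natRec-2^ : ∀ n → natRec 1 (λ _ r → 2 * r) n ≡ 2 ^ n
    natRec-2^ zero    = refl
    natRec-2^ (suc n) = cong (2 *_) (natRec-2^ n)

  π₁ᶜ : Comp π₁
  π₁ᶜ = π₁R computes λ _ → ⇓π₁

  π₂ᶜ : Comp π₂
  π₂ᶜ = π₂R computes λ _ → ⇓π₂

  ℕ-view : ℕ → ⊤ ⊎ ℕ
  ℕ-view zero    = inj₁ tt
  ℕ-view (suc n) = inj₂ n

  ℕ-viewᶜ : Comp ℕ-view
  ℕ-viewᶜ = ext (natRecᶜ {f = λ _ → inj₁ tt} {g = λ (_ , n , _) → inj₂ n} idᶜ (constᶜ _) (inj₂ᶜ ∘ᶜ fstᶜ ∘ᶜ sndᶜ))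
    λ { zero → refl ; (suc _) → refl }

  instance
    Bool-encoding : Encoding Bool
    Bool-encoding .encode false = encode {⊤ ⊎ ⊤} (inj₁ tt)
    Bool-encoding .encode true  = encode {⊤ ⊎ ⊤} (inj₂ tt)

  Bool-view : Bool → ⊤ ⊎ ⊤
  Bool-view false = inj₁ tt
  Bool-view true  = inj₂ tt

  module _ {A B : Set} {{_ : Encoding A}} {{_ : Encoding B}} where

    ifᶜ : {b : A → Bool} {f g : A → B} → Comp b → Comp f → Comp g →
          Comp λ a → if b a then f a else g a
    ifᶜ {b} {f} {g} p q r =
      ext (caseᶜ {f = g ∘ proj₁} {g = f ∘ proj₁}
                 (recode {f = Bool-view} (λ { false → refl ; true → refl }) ∘ᶜ p) (r ∘ᶜ fstᶜ) (q ∘ᶜ fstᶜ))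
          (λ a → lemma (b a))
      where
      lemma : ∀ {x y : B} b → [ (λ _ → x) , (λ _ → y) ]′ (Bool-view b) ≡ (if b then y else x)
      lemma false = refl
      lemma true  = refl

    natCaseᶜ : {n : A → ℕ} {f : A → B} {g : A × ℕ → B} → Comp n → Comp f → Comp g →
               Comp λ a → [ (λ _ → f a) , (λ k → g (a , k)) ]′ (ℕ-view (n a))
    natCaseᶜ {f = f} p q r = caseᶜ {f = f ∘ proj₁} (ℕ-viewᶜ ∘ᶜ p) (q ∘ᶜ fstᶜ) r

  _≤ᵇᶜ_ : ∀ {A} {{_ : Encoding A}} {f g : A → ℕ} → Comp f → Comp g → Comp λ a → f a ≤ᵇ g a
  _≤ᵇᶜ_ {f = f} {g} p q =
    ext (natCaseᶜ {f = λ _ → true} {g = λ _ → false} (p ∸ᶜ q) (constᶜ true) (constᶜ false))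
        (λ a → lemma (f a) (g a))
    where
    lemma : ∀ m n → [ (λ _ → true) , (λ _ → false) ]′ (ℕ-view (m ∸ n)) ≡ (m ≤ᵇ n)
    lemma zero    zero    = refl
    lemma zero    (suc n) = refl
    lemma (suc m) zero    = refl
    lemma (suc zero) (suc n) = lemma zero n
    lemma (suc (suc m)) (suc n) = lemma (suc m) n

  iterate : {A : Set} → (A → A) → ℕ → A → A
  iterate f zero    a = a
  iterate f (suc n) a = f (iterate f n a)

  iterateᶜ : ∀ {A B} {{_ : Encoding A}} {{_ : Encoding B}} {f : A → A} {k : B → ℕ} {a : B → A} →
             Comp f → Comp k → Comp a → Comp λ b → iterate f (k b) (a b)
  iterateᶜ {f = f} {k} {a} p q r =
    ext (natRecᶜ {g = λ (_ , _ , x) → f x} q r (p ∘ᶜ sndᶜ ∘ᶜ sndᶜ)) (λ b → lemma (k b))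
    where
    lemma : ∀ {x} n → natRec x (λ _ → f) n ≡ iterate f n x
    lemma zero    = refl
    lemma (suc n) = cong f (lemma n)

  module _ {S B : Set} {{_ : Encoding S}} {{_ : Encoding B}} where

    -- The recursion pattern of a stage of the tree construction: one child is followed at each
    -- level and the node is rebuilt on the way back. A bound on the number of levels makes it
    -- primitive recursive.
    descend : (S → B) → (S × B → B) → (S → S) → ℕ → S → B
    descend base up down zero    s = base s
    descend base up down (suc n) s = up (s , descend base up down n (down s))

    -- The recursion is unrolled bottom-up: value j is taken at the (n ∸ j)-th
    -- iterate of the descent map.
    descendᶜ : {base : S → B} {up : S × B → B} {down : S → S} → Comp base → Comp up → Comp down →
               Comp {ℕ × S} λ (n , s) → descend base up down n s
    descendᶜ {base} {up} {down} p q r =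
      ext (natRecᶜ {k = proj₁} {f = λ (n , s) → base (iterate down n s)}
                   {g = λ ((n , s) , j , b) → up (iterate down (n ∸ suc j) s , b)}
            fstᶜ
            (p ∘ᶜ iterateᶜ r fstᶜ sndᶜ)
            (q ∘ᶜ (iterateᶜ r ((fstᶜ ∘ᶜ fstᶜ) ∸ᶜ sucᶜ (fstᶜ ∘ᶜ sndᶜ)) (sndᶜ ∘ᶜ fstᶜ) ,ᶜ sndᶜ ∘ᶜ sndᶜ)))
          (λ (n , s) → trans (lemma n s n ≤-refl) (cong (λ k → descend base up down n (iterate down k s)) (n∸n≡0 n)))
      where
      lemma : ∀ n s j → j ≤ n →
              natRec (base (iterate down n s)) (λ j b → up (iterate down (n ∸ suc j) s , b)) j ≡
              descend base up down j (iterate down (n ∸ j) s)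
      lemma n s zero    _   = refl
      lemma n s (suc j) j<n = cong (λ b → up (iterate down (n ∸ suc j) s , b))
        (trans (lemma n s j (<⇒≤ j<n))
               (cong (λ k → descend base up down j (iterate down k s)) (∸-suc j<n)))
        where
        ∸-suc : suc j ≤ n → n ∸ j ≡ suc (n ∸ suc j)
        ∸-suc j<n = sym (trans (sym (+-∸-assoc 1 j<n)) refl)

  -- A stack machine simulating Rec

  instance
    List-encoding : ∀ {A} {{_ : Encoding A}} → Encoding (List A)
    List-encoding {A} .encode = encodeList
      where
      encodeList : List A → ℕ
      encodeList []       = pair 0 0
      encodeList (x ∷ xs) = pair 1 (pair (encode x) (encodeList xs))

  List-view : ∀ {A : Set} → List A → ⊤ ⊎ (A × List A)
  List-view []       = inj₁ tt
  List-view (x ∷ xs) = inj₂ (x , xs)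

  List-viewᶜ : ∀ {A} {{_ : Encoding A}} → Comp (List-view {A})
  List-viewᶜ = recode λ { [] → refl ; (_ ∷ _) → refl }

  module _ {A B : Set} {{_ : Encoding A}} {{_ : Encoding B}} where

    infixr 5 _∷ᶜ_
    _∷ᶜ_ : {f : B → A} {g : B → List A} → Comp f → Comp g → Comp λ b → f b ∷ g b
    p ∷ᶜ q = recode {f = λ { (inj₁ _) → [] ; (inj₂ (x , xs)) → x ∷ xs }} (λ { (inj₁ _) → refl ; (inj₂ _) → refl })
             ∘ᶜ inj₂ᶜ {⊤} ∘ᶜ (p ,ᶜ q)

  -- Programs are unary combinators, coded as a tag paired with a body. Every number is a program,
  -- since any tag above 6 is read as a loop.
  succC fstC sndC idC zeroC : ℕ
  zeroC = pair 0 0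
  succC = pair 1 0
  fstC  = pair 2 0
  sndC  = pair 3 0
  idC   = pair 4 0

  pairC compC : ℕ → ℕ → ℕ
  pairC f g = pair 5 (pair f g)
  compC f g = pair 6 (pair f g)

  loopC : ℕ → ℕ
  loopC f = pair 7 f

  Frame : Set
  Frame = (ℕ × ℕ) ⊎ ℕ ⊎ ℕ

  pattern thenPair g v = inj₁ (g , v)
  pattern pairWith a   = inj₂ (inj₁ a)
  pattern thenEval f   = inj₂ (inj₂ f)

  Config : Set
  Config = (ℕ × ℕ × List Frame) ⊎ (ℕ × List Frame)

  pattern ev c v K = inj₁ (c , v , K)
  pattern ret v K  = inj₂ (v , K)

  -- The loop runs its body on (k , s) while the state is (k + 1 , s), and
  -- returns s when the state is (0 , s).
  evalStep : ℕ × ℕ × List Frame → Config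
  evalStep (c , v , K) =
    if π₁ c ≤ᵇ 0 then ret 0 K else
    if π₁ c ≤ᵇ 1 then ret (suc v) K else
    if π₁ c ≤ᵇ 2 then ret (π₁ v) K else
    if π₁ c ≤ᵇ 3 then ret (π₂ v) K else
    if π₁ c ≤ᵇ 4 then ret v K else
    if π₁ c ≤ᵇ 5 then ev (π₁ (π₂ c)) v (thenPair (π₂ (π₂ c)) v ∷ K) else
    if π₁ c ≤ᵇ 6 then ev (π₂ (π₂ c)) v (thenEval (π₁ (π₂ c)) ∷ K) else
    [ (λ _ → ret (π₂ v) K) , (λ k → ev (π₂ c) (pair k (π₂ v)) (thenEval c ∷ K)) ]′ (ℕ-view (π₁ v))

  returnStep : ℕ × List Frame → Config
  returnStep (v , [])               = ret v []
  returnStep (v , thenPair g u ∷ K) = ev g u (pairWith v ∷ K)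
  returnStep (v , pairWith a ∷ K)   = ret (pair a v) K
  returnStep (v , thenEval f ∷ K)   = ev f v K

  machineStep : Config → Config
  machineStep = [ evalStep , returnStep ]′

  evalStepᶜ : Comp evalStep
  evalStepᶜ =
    ifᶜ (tag ≤ᵇᶜ constᶜ 0) (retᶜ (constᶜ 0)) $
    ifᶜ (tag ≤ᵇᶜ constᶜ 1) (retᶜ (sucᶜ val)) $
    ifᶜ (tag ≤ᵇᶜ constᶜ 2) (retᶜ (π₁ᶜ ∘ᶜ val)) $
    ifᶜ (tag ≤ᵇᶜ constᶜ 3) (retᶜ (π₂ᶜ ∘ᶜ val)) $
    ifᶜ (tag ≤ᵇᶜ constᶜ 4) (retᶜ val) $
    ifᶜ (tag ≤ᵇᶜ constᶜ 5) (inj₁ᶜ ∘ᶜ (π₁ᶜ ∘ᶜ body ,ᶜ val ,ᶜ ((inj₁ᶜ ∘ᶜ (π₂ᶜ ∘ᶜ body ,ᶜ val)) ∷ᶜ stack))) $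
    ifᶜ (tag ≤ᵇᶜ constᶜ 6) (inj₁ᶜ ∘ᶜ (π₂ᶜ ∘ᶜ body ,ᶜ val ,ᶜ ((inj₂ᶜ ∘ᶜ inj₂ᶜ ∘ᶜ π₁ᶜ ∘ᶜ body) ∷ᶜ stack))) $
    natCaseᶜ {g = λ ((c , v , K) , k) → ev (π₂ c) (pair k (π₂ v)) (thenEval c ∷ K)} (π₁ᶜ ∘ᶜ val) (retᶜ (π₂ᶜ ∘ᶜ val))
      (inj₁ᶜ ∘ᶜ (body ∘ᶜ fstᶜ ,ᶜ pairᶜ sndᶜ (π₂ᶜ ∘ᶜ val ∘ᶜ fstᶜ) ,ᶜ
                 ((inj₂ᶜ ∘ᶜ inj₂ᶜ ∘ᶜ fstᶜ ∘ᶜ fstᶜ) ∷ᶜ (stack ∘ᶜ fstᶜ))))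
    where
    tag : Comp {ℕ × ℕ × List Frame} λ (c , _) → π₁ c
    tag = π₁ᶜ ∘ᶜ fstᶜ
    body : Comp {ℕ × ℕ × List Frame} λ (c , _) → π₂ c
    body = π₂ᶜ ∘ᶜ fstᶜ
    val : Comp {ℕ × ℕ × List Frame} λ (_ , v , _) → v
    val = fstᶜ ∘ᶜ sndᶜ
    stack : Comp {ℕ × ℕ × List Frame} λ (_ , _ , K) → K
    stack = sndᶜ ∘ᶜ sndᶜ
    retᶜ : {f : ℕ × ℕ × List Frame → ℕ} → Comp f → Comp {B = Config} λ s → ret (f s) (proj₂ (proj₂ s))
    retᶜ p = inj₂ᶜ ∘ᶜ (p ,ᶜ stack)

  returnStepᶜ : Comp returnStep
  returnStepᶜ = ext
    (caseᶜ {f = λ { ((v , _) , _) → ret v [] }}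
           {g = λ ((v , _) , F , K) → [ (λ (g , u) → ev g u (pairWith v ∷ K)) ,
                                        [ (λ a → ret (pair a v) K) , (λ f → ev f v K) ]′ ]′ F}
      (List-viewᶜ ∘ᶜ sndᶜ)
      (inj₂ᶜ ∘ᶜ (fstᶜ ∘ᶜ fstᶜ ,ᶜ constᶜ []))
      (caseᶜ {f = λ (((v , _) , _ , K) , g , u) → ev g u (pairWith v ∷ K)}
             {g = λ (((v , _) , _ , K) , F) → [ (λ a → ret (pair a v) K) , (λ f → ev f v K) ]′ F}
        (fstᶜ ∘ᶜ sndᶜ)
        (inj₁ᶜ ∘ᶜ (fstᶜ ∘ᶜ sndᶜ ,ᶜ sndᶜ ∘ᶜ sndᶜ ,ᶜ
                   ((inj₂ᶜ ∘ᶜ inj₁ᶜ ∘ᶜ fstᶜ ∘ᶜ fstᶜ ∘ᶜ fstᶜ) ∷ᶜ (sndᶜ ∘ᶜ sndᶜ ∘ᶜ fstᶜ))))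
        (caseᶜ {f = λ ((((v , _) , _ , K) , _) , a) → ret (pair a v) K}
               {g = λ ((((v , _) , _ , K) , _) , f) → ev f v K}
          sndᶜ
          (inj₂ᶜ ∘ᶜ (pairᶜ sndᶜ (fstᶜ ∘ᶜ fstᶜ ∘ᶜ fstᶜ ∘ᶜ fstᶜ) ,ᶜ (sndᶜ ∘ᶜ sndᶜ ∘ᶜ fstᶜ ∘ᶜ fstᶜ)))
          (inj₁ᶜ ∘ᶜ (sndᶜ ,ᶜ (fstᶜ ∘ᶜ fstᶜ ∘ᶜ fstᶜ ∘ᶜ fstᶜ) ,ᶜ (sndᶜ ∘ᶜ sndᶜ ∘ᶜ fstᶜ ∘ᶜ fstᶜ))))))
    λ { (v , []) → refl
      ; (v , thenPair _ _ ∷ _) → refl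
      ; (v , pairWith _ ∷ _) → refl
      ; (v , thenEval _ ∷ _) → refl }

  machineStepᶜ : Comp machineStep
  machineStepᶜ = caseᶜ {f = evalStep ∘ proj₂} {g = returnStep ∘ proj₂} idᶜ (evalStepᶜ ∘ᶜ sndᶜ) (returnStepᶜ ∘ᶜ sndᶜ)

  iterate-+ : ∀ {A : Set} (f : A → A) m n a → iterate f (m + n) a ≡ iterate f m (iterate f n a)
  iterate-+ f zero    n a = refl
  iterate-+ f (suc m) n a = cong f (iterate-+ f m n a)

  infix 4 _⟶*_
  _⟶*_ : Config → Config → Set
  s ⟶* t = ∃ λ n → iterate machineStep n s ≡ t

  ⟶*-trans : ∀ {s t u} → s ⟶* t → t ⟶* u → s ⟶* u
  ⟶*-trans (m , refl) (n , refl) = n + m , iterate-+ machineStep n m _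

  infixr 2 _then_
  _then_ : ∀ {s t u} → machineStep s ≡ t → t ⟶* u → s ⟶* u
  p then q = ⟶*-trans (1 , p) q

  infix 4 _▷_⇒_
  _▷_⇒_ : ℕ → ℕ → ℕ → Set
  c ▷ v ⇒ w = ∀ K → ev c v K ⟶* ret w K

  ▷-resp : ∀ {c k k′ s w} → k ≡ k′ → c ▷ pair k s ⇒ w → c ▷ pair k′ s ⇒ w
  ▷-resp refl p = p

  done : ∀ {s} → s ⟶* s
  done = 0 , refl

  ▷zero : ∀ {v} → zeroC ▷ v ⇒ 0
  ▷zero {v} K = step then done
    where
    step : evalStep (zeroC , v , K) ≡ ret 0 K
    step rewrite π₁-pair 0 0 = refl

  ▷succ : ∀ {v} → succC ▷ v ⇒ suc v
  ▷succ {v} K = step then done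
    where
    step : evalStep (succC , v , K) ≡ ret (suc v) K
    step rewrite π₁-pair 1 0 = refl

  ▷fst : ∀ {a b} → fstC ▷ pair a b ⇒ a
  ▷fst {a} {b} K = step then done
    where
    step : evalStep (fstC , pair a b , K) ≡ ret a K
    step rewrite π₁-pair 2 0 | π₁-pair a b = refl

  ▷snd : ∀ {a b} → sndC ▷ pair a b ⇒ b
  ▷snd {a} {b} K = step then done
    where
    step : evalStep (sndC , pair a b , K) ≡ ret b K
    step rewrite π₁-pair 3 0 | π₂-pair a b = refl

  ▷id : ∀ {v} → idC ▷ v ⇒ v
  ▷id {v} K = step then done
    where
    step : evalStep (idC , v , K) ≡ ret v K
    step rewrite π₁-pair 4 0 = refl

  ▷pair : ∀ {f g v a b} → f ▷ v ⇒ a → g ▷ v ⇒ b → pairC f g ▷ v ⇒ pair a b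
  ▷pair {f} {g} {v} {a} p q K = step then ⟶*-trans (p _) (refl then ⟶*-trans (q _) (refl then done))
    where
    step : evalStep (pairC f g , v , K) ≡ ev f v (thenPair g v ∷ K)
    step rewrite π₁-pair 5 (pair f g) | π₂-pair 5 (pair f g) | π₁-pair f g | π₂-pair f g = refl

  ▷comp : ∀ {f g v a b} → g ▷ v ⇒ a → f ▷ a ⇒ b → compC f g ▷ v ⇒ b
  ▷comp {f} {g} {v} p q K = step then ⟶*-trans (p _) (refl then q _)
    where
    step : evalStep (compC f g , v , K) ≡ ev g v (thenEval f ∷ K)
    step rewrite π₁-pair 6 (pair f g) | π₂-pair 6 (pair f g) | π₁-pair f g | π₂-pair f g = refl

  ▷loop-zero : ∀ {f s} → loopC f ▷ pair 0 s ⇒ s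
  ▷loop-zero {f} {s} K = step then done
    where
    step : evalStep (loopC f , pair 0 s , K) ≡ ret s K
    step rewrite π₁-pair 7 f | π₁-pair 0 s | π₂-pair 0 s = refl

  ▷loop-suc : ∀ {f k s s′ r} → f ▷ pair k s ⇒ s′ → loopC f ▷ s′ ⇒ r → loopC f ▷ pair (suc k) s ⇒ r
  ▷loop-suc {f} {k} {s} p q K = step then ⟶*-trans (p _) (refl then q _)
    where
    step : evalStep (loopC f , pair (suc k) s , K) ≡ ev f (pair k s) (thenEval (loopC f) ∷ K)
    step rewrite π₁-pair 7 f | π₂-pair 7 f | π₁-pair (suc k) s | π₂-pair (suc k) s = refl

  encodeVec : ∀ {n} → Vec ℕ n → ℕ
  encodeVec []       = 0
  encodeVec (x ∷ xs) = pair x (encodeVec xs)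

  -- The loops for prec and mu run on states (flag , (i , (r , xs))).
  indexC paramsC : ℕ
  indexC  = compC fstC sndC
  paramsC = compC sndC (compC sndC sndC)

  module _ {k i r xs : ℕ} where

    ▷index : indexC ▷ pair k (pair i (pair r xs)) ⇒ i
    ▷index = ▷comp ▷snd ▷fst

    ▷params : paramsC ▷ pair k (pair i (pair r xs)) ⇒ xs
    ▷params = ▷comp (▷comp ▷snd ▷snd) ▷snd

  precInitC precBodyC : ℕ → ℕ
  precInitC g = pairC fstC (pairC zeroC (pairC (compC g sndC) sndC))
  precBodyC h = pairC fstC (pairC (compC succC indexC) (pairC (compC h sndC) paramsC))

  -- The flag starts at 1 to force a first trial; afterwards it is the latest value of f, so the
  -- loop stops at a zero. By then the index has moved on, and the slot r holds the index just
  -- tested, which is the answer.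
  muInitC : ℕ
  muInitC = pairC (compC succC zeroC) (pairC zeroC (pairC zeroC idC))

  muBodyC : ℕ → ℕ
  muBodyC f = pairC (compC f (pairC indexC paramsC)) (pairC (compC succC indexC) (pairC indexC paramsC))

  projC : ∀ {n} → Fin n → ℕ
  projC zero    = fstC
  projC (suc i) = compC (projC i) sndC

  compile : ∀ {n} → Rec n → ℕ
  compileVec : ∀ {m n} → Vec (Rec n) m → ℕ

  compile zer         = zeroC
  compile succ        = compC succC fstC
  compile (proj i)    = projC i
  compile (comp f gs) = compC (compile f) (compileVec gs)
  compile (prec g h)  = compC (compC fstC sndC) (compC (loopC (precBodyC (compile h))) (precInitC (compile g)))
  compile (mu f)      = compC (compC fstC sndC) (compC (loopC (muBodyC (compile f))) muInitC)

  compileVec []       = zeroC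
  compileVec (g ∷ gs) = pairC (compile g) (compileVec gs)

  ▷proj : ∀ {n} (i : Fin n) xs → projC i ▷ encodeVec xs ⇒ lookup xs i
  ▷proj zero    (x ∷ xs) = ▷fst
  ▷proj (suc i) (x ∷ xs) = ▷comp ▷snd (▷proj i xs)

  compile-sound : ∀ {n} {c : Rec n} {xs y} → c [ xs ]⇓ y → compile c ▷ encodeVec xs ⇒ y
  compileVec-sound : ∀ {m n} {gs : Vec (Rec n) m} {xs ys} → Pointwise (λ g y → g [ xs ]⇓ y) gs ys →
                     compileVec gs ▷ encodeVec xs ⇒ encodeVec ys
  -- The loop counter falls while the recursion index rises, so a derivation ends where the loop
  -- ends. Stating the claim relative to an arbitrary continuation with m rounds left lets the
  -- induction peel off the last round.
  prec-sound : ∀ {n} {g : Rec n} {h k xs r} → prec g h [ k ∷ xs ]⇓ r →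
               ∃ λ r₀ → compile g ▷ encodeVec xs ⇒ r₀ × (∀ {m w} →
                 loopC (precBodyC (compile h)) ▷ pair m (pair k (pair r (encodeVec xs))) ⇒ w →
                 loopC (precBodyC (compile h)) ▷ pair (k + m) (pair 0 (pair r₀ (encodeVec xs))) ⇒ w)
  mu-sound : ∀ {n} {f : Rec (suc n)} {xs y} → f [ y ∷ xs ]⇓ 0 →
             (∀ i → i < y → ∃ λ k → f [ i ∷ xs ]⇓ suc k) →
             ∀ d i → d + i ≡ y → ∀ {k r} →
             loopC (muBodyC (compile f)) ▷ pair (suc k) (pair i (pair r (encodeVec xs))) ⇒
               pair (suc y) (pair y (encodeVec xs))

  compile-sound ⇓zer = ▷zero
  compile-sound ⇓succ = ▷comp ▷fst ▷succ
  compile-sound (⇓proj {i = i} {xs}) = ▷proj i xs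
  compile-sound (⇓comp ps q) = ▷comp (compileVec-sound ps) (compile-sound q)
  compile-sound {xs = k ∷ xs} d@(⇓prec-zero _) with r₀ , p , q ← prec-sound d =
    ▷comp (▷comp (▷pair ▷fst (▷pair ▷zero (▷pair (▷comp ▷snd p) ▷snd))) (q ▷loop-zero)) (▷comp ▷snd ▷fst)
  compile-sound {xs = k ∷ xs} d@(⇓prec-suc {k = k′} _ _) with r₀ , p , q ← prec-sound d =
    ▷comp (▷comp (▷pair ▷fst (▷pair ▷zero (▷pair (▷comp ▷snd p) ▷snd)))
      (▷-resp (+-identityʳ (suc k′)) (q ▷loop-zero))) (▷comp ▷snd ▷fst)
  compile-sound (⇓mu {y = y} p q) =
    ▷comp (▷comp (▷pair (▷comp ▷zero ▷succ) (▷pair ▷zero (▷pair ▷zero ▷id)))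
                 (mu-sound p q y 0 (+-identityʳ y)))
          (▷comp ▷snd ▷fst)

  compileVec-sound []       = ▷zero
  compileVec-sound (p ∷ ps) = ▷pair (compile-sound p) (compileVec-sound ps)

  prec-sound (⇓prec-zero p) = _ , compile-sound p , id
  prec-sound {k = suc k} (⇓prec-suc p q) with r₀ , p₀ , run ← prec-sound p =
    r₀ , p₀ , λ {m} {w} p∞ → ▷-resp (+-suc k m)
      (run (▷loop-suc (▷pair ▷fst (▷pair (▷comp ▷index ▷succ)
                                         (▷pair (▷comp ▷snd (compile-sound q)) ▷params))) p∞))

  mu-sound {f = f} {xs} p q zero i refl =
    ▷loop-suc (▷pair (▷comp (▷pair ▷index ▷params) (compile-sound p))
                     (▷pair (▷comp ▷index ▷succ) (▷pair ▷index ▷params))) ▷loop-zero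
  mu-sound p q (suc d) i refl =
    ▷loop-suc (▷pair (▷comp (▷pair ▷index ▷params) (compile-sound (proj₂ (q i (s≤s (m≤n+m i d))))))
                     (▷pair (▷comp ▷index ▷succ) (▷pair ▷index ▷params)))
              (mu-sound p q d (suc i) (+-suc d i))

  -- Step-bounded convergence and universality

  output≤ : ℕ → Config → Bool
  output≤ t (ev _ _ _)      = false
  output≤ t (ret v [])      = v ≤ᵇ t
  output≤ t (ret v (_ ∷ _)) = false

  converges : ℕ → ℕ → ℕ → Bool
  converges e n t = output≤ t (iterate machineStep t (ev e (pair n 0) []))

  convergesᶜ : Comp {ℕ × ℕ × ℕ} λ (e , n , t) → converges e n t
  convergesᶜ = output≤ᶜ ∘ᶜ (sndᶜ ∘ᶜ sndᶜ ,ᶜ iterateᶜ machineStepᶜ (sndᶜ ∘ᶜ sndᶜ)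
                 (inj₁ᶜ ∘ᶜ (fstᶜ ,ᶜ pairᶜ (fstᶜ ∘ᶜ sndᶜ) (constᶜ 0) ,ᶜ constᶜ [])))
    where
    output≤ᶜ : Comp {ℕ × Config} λ (t , s) → output≤ t s
    output≤ᶜ = ext
      (caseᶜ {f = λ _ → false} {g = λ ((t , _) , v , K) → [ (λ _ → v ≤ᵇ t) , (λ _ → false) ]′ (List-view K)}
        sndᶜ (constᶜ false)
        (caseᶜ {f = λ (((t , _) , v , _) , _) → v ≤ᵇ t} {g = λ _ → false}
          (List-viewᶜ ∘ᶜ sndᶜ ∘ᶜ sndᶜ)
          ((fstᶜ ∘ᶜ sndᶜ ∘ᶜ fstᶜ) ≤ᵇᶜ (fstᶜ ∘ᶜ fstᶜ ∘ᶜ fstᶜ))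
          (constᶜ false)))
      λ { (t , ev _ _ _) → refl ; (t , ret v []) → refl ; (t , ret v (_ ∷ _)) → refl }

  halted : ∀ v n → iterate machineStep n (ret v []) ≡ ret v []
  halted v zero    = refl
  halted v (suc n) rewrite halted v n = refl

  ≤ᵇ-true : ∀ {m n} → m ≤ n → (m ≤ᵇ n) ≡ true
  ≤ᵇ-true {m} {n} m≤n with m ≤ᵇ n | ≤⇒≤ᵇ m≤n
  ... | true | _ = refl

  ≤ᵇ-true⁻¹ : ∀ {m n} → (m ≤ᵇ n) ≡ true → m ≤ n
  ≤ᵇ-true⁻¹ {m} {n} eq = ≤ᵇ⇒≤ m n (subst T (sym eq) tt)

  -- The construction never reads a value of f: both a modulus and a subsequence enter only through
  -- certified bounds of the form f n ≤ t.
  record Decides (conv : ℕ → ℕ → Bool) (f : ℕ → ℕ) : Set where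
    field
      bounds : ∀ {n t} → conv n t ≡ true → f n ≤ t
      halts  : ∀ n → ∃ λ t₀ → ∀ {t} → t₀ ≤ t → conv n t ≡ true

  universal : ∀ {f} → ComputableFun f → ∃ λ e → Decides (converges e) f
  universal {f} (c , c⇓) = compile c , record { bounds = bounds ; halts = halts }
    where
    start : ℕ → Config
    start n = ev (compile c) (pair n 0) []

    time : ℕ → ℕ
    time n = proj₁ (compile-sound (c⇓ n) [])

    after : ∀ n k → iterate machineStep (k + time n) (start n) ≡ ret (f n) []
    after n k = trans (iterate-+ machineStep k (time n) (start n))
      (trans (cong (iterate machineStep k) (proj₂ (compile-sound (c⇓ n) []))) (halted (f n) k))

    bounds : ∀ {n t} → converges (compile c) n t ≡ true → f n ≤ t
    bounds {n} {t} conv with iterate machineStep t (start n) in eq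
    ... | ret v [] = subst (_≤ t) (output v≡) (≤ᵇ-true⁻¹ {v} conv)
      where
      -- Halted configurations are fixed points, so the outputs found at steps t and `time n` agree
      -- at step t + `time n`.
      v≡ : _≡_ {A = Config} (ret v []) (ret (f n) [])
      v≡ = trans (sym (halted v (time n)))
        (trans (cong (iterate machineStep (time n)) (sym eq))
          (trans (sym (iterate-+ machineStep (time n) t (start n)))
            (trans (cong (λ k → iterate machineStep k (start n)) (+-comm (time n) t)) (after n t))))
      output : ∀ {v w} → _≡_ {A = Config} (ret v []) (ret w []) → v ≡ w
      output refl = refl

    halts : ∀ n → ∃ λ t₀ → ∀ {t} → t₀ ≤ t → converges (compile c) n t ≡ true
    -- The first summand allows the machine to halt, the second lets the output pass the test v ≤ t.
    halts n = time n + f n , λ {t} t₀≤t → trans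
      (cong (output≤ t) (trans (cong (λ k → iterate machineStep k (start n))
                                 (sym (m∸n+n≡m (≤-trans (m≤m+n (time n) (f n)) t₀≤t))))
                               (after n (t ∸ time n))))
      (≤ᵇ-true (≤-trans (m≤n+m (f n) (time n)) t₀≤t))

open Computability
open import Data.Rational.Base as ℚ using (ℚ; 0ℚ; 1ℚ; _/_; _+_; _-_; -_; _<_; _≤_; toℚᵘ; fromℚᵘ)
open import Data.Rational.Properties
  using ( ≤-refl; ≤-reflexive; ≤-trans; <⇒≤; <-≤-trans; ≤-<-trans; <-trans; <-dense; <-irrefl; ≮⇒≥
        ; +-mono-≤; +-mono-≤-<; +-monoˡ-≤; +-monoʳ-≤; +-monoˡ-<; +-monoʳ-<
        ; +-identityˡ; +-identityʳ; +-assoc; +-inverseʳ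
        ; toℚᵘ-injective; toℚᵘ-fromℚᵘ; toℚᵘ-homo-+; fromℚᵘ-cong; fromℚᵘ-toℚᵘ
        ; toℚᵘ-cancel-≤; toℚᵘ-mono-<; positive⁻¹; normalize-pos)
import Data.Rational.Properties as ℚ
open import Data.Rational.Unnormalised.Base as ℚᵘ using (mkℚᵘ; *≡*; *≤*; *<*)
import Data.Rational.Unnormalised.Properties as ℚᵘ

-- Rational arithmetic

ℚ-ring : AlmostCommutativeRing 0ℓ 0ℓ
ℚ-ring = fromCommutativeRing ℚ.+-*-commutativeRing (λ p → dec⇒maybe (0ℚ ℚ.≟ p))

-- Reduces a linear inequality to an equality that the ring solver can prove.
linear : ∀ {l r x y} → l ≤ r → x + r ≡ y + l → x ≤ y
linear {l} {r} {x} {y} l≤r eq = subst₂ _≤_ x+l-l y+l-l (+-monoˡ-≤ (- l) (begin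
  x + l  ≤⟨ +-monoʳ-≤ x l≤r ⟩
  x + r  ≡⟨ eq ⟩
  y + l  ∎))
  where
  open ℚ.≤-Reasoning
  x+l-l : x + l - l ≡ x
  x+l-l = trans (+-assoc x l (- l)) (trans (cong (x +_) (+-inverseʳ l)) (+-identityʳ x))
  y+l-l : y + l - l ≡ y
  y+l-l = trans (+-assoc y l (- l)) (trans (cong (y +_) (+-inverseʳ l)) (+-identityʳ y))

-- The ring identities behind the applications of linear.

rearrange₁ : ∀ h → 0ℚ + (h + 0ℚ + (0ℚ + 0ℚ)) ≡ 0ℚ + h
rearrange₁ = solve-∀ ℚ-ring

rearrange₂ : ∀ r p x y h → r + (0ℚ + 0ℚ + (0ℚ + 0ℚ)) + (p + (x + y) + h) ≡ r + p + (x + y) + h + 0ℚ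
rearrange₂ = solve-∀ ℚ-ring

rearrange₃ : ∀ r u p x y h → u + (r + p + (x + 0ℚ)) + (y + h) ≡ r + (u + p) + (x + y) + h + 0ℚ
rearrange₃ = solve-∀ ℚ-ring

rearrange₄ : ∀ r x′ x y h → 0ℚ + (r + 0ℚ + (x′ + 0ℚ)) + (x + h + y) ≡ r + 0ℚ + (x + y) + h + (0ℚ + x′ + 0ℚ)
rearrange₄ = solve-∀ ℚ-ring

rearrange₅ : ∀ r u x′ x y h → 0ℚ + (r + u + (x′ + 0ℚ)) + (x + h + y) ≡ r + 0ℚ + (x + y) + h + (u + x′ + 0ℚ)
rearrange₅ = solve-∀ ℚ-ring

rearrange₆ : ∀ r p x y′ y h o → o + (r + p + (x + y′)) + (y + h) ≡ r + p + (x + y) + h + (o + y′)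
rearrange₆ = solve-∀ ℚ-ring

rearrange₇ : ∀ x → 0ℚ + (0ℚ + x + 0ℚ) ≡ 0ℚ + x
rearrange₇ = solve-∀ ℚ-ring

rearrange₈ : ∀ u x → 0ℚ + (u + x + 0ℚ) ≡ u + x
rearrange₈ = solve-∀ ℚ-ring

rearrange₉ : ∀ o p x y′ y h → o + (p + x + y′) + (y + h) ≡ p + x + y + h + (o + y′)
rearrange₉ = solve-∀ ℚ-ring

rearrange₁₀ : ∀ u p x y h → u + (p + x + 0ℚ) + (y + h) ≡ u + p + x + y + h + 0ℚ
rearrange₁₀ = solve-∀ ℚ-ring

rearrange₁₁ : ∀ x′ x y h → 0ℚ + (0ℚ + x′ + 0ℚ) + (x + h + y) ≡ 0ℚ + x + y + h + (0ℚ + x′ + 0ℚ)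
rearrange₁₁ = solve-∀ ℚ-ring

rearrange₁₂ : ∀ u x′ x y h → 0ℚ + (u + x′ + 0ℚ) + (x + h + y) ≡ 0ℚ + x + y + h + (u + x′ + 0ℚ)
rearrange₁₂ = solve-∀ ℚ-ring

rearrange₁₃ : ∀ s x y → s + (x + y) ≡ 0ℚ + x + y + (s + 0ℚ)
rearrange₁₃ = solve-∀ ℚ-ring

rearrange₁₄ : ∀ o s → s + o ≡ o + s + 0ℚ
rearrange₁₄ = solve-∀ ℚ-ring

rearrange₁₅ : ∀ u p x → u + p + x + 0ℚ ≡ u + (p + x + 0ℚ)
rearrange₁₅ = solve-∀ ℚ-ring

rearrange₁₆ : ∀ x x′ → 0ℚ + x + 0ℚ + (0ℚ + x′) ≡ 0ℚ + (0ℚ + x′ + 0ℚ) + x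
rearrange₁₆ = solve-∀ ℚ-ring

rearrange₁₇ : ∀ u x x′ → 0ℚ + x + 0ℚ + (u + x′) ≡ 0ℚ + (u + x′ + 0ℚ) + x
rearrange₁₇ = solve-∀ ℚ-ring

rearrange₁₈ : ∀ x o p p′ h → x + o + p′ + h + (p + h) ≡ x + p + (h + h) + (o + p′)
rearrange₁₈ = solve-∀ ℚ-ring

rearrange₁₉ : ∀ x u → x + (u + 0ℚ + (0ℚ + 0ℚ)) + u ≡ x + (u + u)
rearrange₁₉ = solve-∀ ℚ-ring

rearrange₂₀ : ∀ a b p q h → p + q + (a + h + b) ≡ h + (b + p + q + a)
rearrange₂₀ = solve-∀ ℚ-ring

rearrange₂₁ : ∀ a b h e → b - a - e + (a + h) ≡ h - e + b
rearrange₂₁ = solve-∀ ℚ-ring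

rearrange₂₂ : ∀ y x b h → y + (x + b + h) ≡ x + h + (y + b)
rearrange₂₂ = solve-∀ ℚ-ring

rearrange₂₃ : ∀ y b h → y - h + (b + h) ≡ y + b
rearrange₂₃ = solve-∀ ℚ-ring

fromℚᵘ-+ : ∀ p q → fromℚᵘ p + fromℚᵘ q ≡ fromℚᵘ (p ℚᵘ.+ q)
fromℚᵘ-+ p q = toℚᵘ-injective (begin-equality
  toℚᵘ (fromℚᵘ p + fromℚᵘ q)              ≃⟨ toℚᵘ-homo-+ (fromℚᵘ p) (fromℚᵘ q) ⟩
  toℚᵘ (fromℚᵘ p) ℚᵘ.+ toℚᵘ (fromℚᵘ q)    ≃⟨ ℚᵘ.+-cong (toℚᵘ-fromℚᵘ p) (toℚᵘ-fromℚᵘ q) ⟩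
  p ℚᵘ.+ q                                ≃⟨ toℚᵘ-fromℚᵘ (p ℚᵘ.+ q) ⟨
  toℚᵘ (fromℚᵘ (p ℚᵘ.+ q))                ∎)
  where open ℚᵘ.≤-Reasoning

/-add : ∀ a b c d .{{_ : NonZero b}} .{{_ : NonZero d}} .{{_ : NonZero (b ℕ.* d)}} →
        (ℤ.+ a) / b + (ℤ.+ c) / d ≡ (ℤ.+ (a ℕ.* d ℕ.+ c ℕ.* b)) / (b ℕ.* d)
/-add a (suc b) c (suc d) = trans (fromℚᵘ-+ (mkℚᵘ (ℤ.+ a) b) (mkℚᵘ (ℤ.+ c) d))
  (cong (λ n → n / (suc b ℕ.* suc d)) (cong₂ ℤ._+_ (sym (ℤ.pos-* a (suc d))) (sym (ℤ.pos-* c (suc b)))))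

/-≤ : ∀ a b c d .{{_ : NonZero b}} .{{_ : NonZero d}} →
      a ℕ.* d ℕ.≤ c ℕ.* b → (ℤ.+ a) / b ≤ (ℤ.+ c) / d
/-≤ a (suc b) c (suc d) ad≤cb = toℚᵘ-cancel-≤ (begin
  toℚᵘ ((ℤ.+ a) / suc b)  ≃⟨ toℚᵘ-fromℚᵘ (mkℚᵘ (ℤ.+ a) b) ⟩
  mkℚᵘ (ℤ.+ a) b          ≤⟨ *≤* (subst₂ ℤ._≤_ (ℤ.pos-* a (suc d)) (ℤ.pos-* c (suc b)) (ℤ.+≤+ ad≤cb)) ⟩
  mkℚᵘ (ℤ.+ c) d          ≃⟨ toℚᵘ-fromℚᵘ (mkℚᵘ (ℤ.+ c) d) ⟨
  toℚᵘ ((ℤ.+ c) / suc d)  ∎)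
  where open ℚᵘ.≤-Reasoning

/-<⁻¹ : ∀ a b c d .{{_ : NonZero b}} .{{_ : NonZero d}} →
        (ℤ.+ a) / b < (ℤ.+ c) / d → a ℕ.* d ℕ.< c ℕ.* b
/-<⁻¹ a (suc b) c (suc d) lt
  with ℚᵘ.<-respˡ-≃ (toℚᵘ-fromℚᵘ (mkℚᵘ (ℤ.+ a) b))
         (ℚᵘ.<-respʳ-≃ (toℚᵘ-fromℚᵘ (mkℚᵘ (ℤ.+ c) d)) (toℚᵘ-mono-< lt))
... | *<* lt′ = ℤ.drop‿+<+ (subst₂ ℤ._<_ (sym (ℤ.pos-* a (suc d))) (sym (ℤ.pos-* c (suc b))) lt′)

/-≡ : ∀ a b c d .{{_ : NonZero b}} .{{_ : NonZero d}} →
      a ℕ.* d ≡ c ℕ.* b → (ℤ.+ a) / b ≡ (ℤ.+ c) / d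
/-≡ a b c d eq = ℚ.≤-antisym (/-≤ a b c d (ℕ.≤-reflexive eq)) (/-≤ c d a b (ℕ.≤-reflexive (sym eq)))

/-pos : ∀ a b .{{_ : NonZero b}} → 0ℚ < (ℤ.+ suc a) / b
/-pos a b = positive⁻¹ ((ℤ.+ suc a) / b) {{normalize-pos (suc a) b}}

2^-positive : ∀ n → 0ℚ < 2^- n
2^-positive n = /-pos 0 (2 ℕ.^ n) {{ℕ.m^n≢0 2 n}}

2^-double : ∀ n → 2^- suc n + 2^- suc n ≡ 2^- n
2^-double n = trans (/-add 1 D 1 D) (/-≡ (1 ℕ.* D ℕ.+ 1 ℕ.* D) (D ℕ.* D) 1 d (begin
  (1 ℕ.* D ℕ.+ 1 ℕ.* D) ℕ.* d  ≡⟨ cong₂ (λ a b → (a ℕ.+ b) ℕ.* d) (ℕ.*-identityˡ D) (ℕ.*-identityˡ D) ⟩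
  (D ℕ.+ D) ℕ.* d              ≡⟨ cong (λ a → (D ℕ.+ a) ℕ.* d) (ℕ.+-identityʳ D) ⟨
  2 ℕ.* D ℕ.* d                ≡⟨ ℕ.*-assoc 2 D d ⟩
  2 ℕ.* (D ℕ.* d)              ≡⟨ cong (2 ℕ.*_) (ℕ.*-comm D d) ⟩
  2 ℕ.* (d ℕ.* D)              ≡⟨ ℕ.*-assoc 2 d D ⟨
  D ℕ.* D                      ≡⟨ ℕ.*-identityˡ (D ℕ.* D) ⟨
  1 ℕ.* (D ℕ.* D)              ∎))
  where
  open ≡-Reasoning
  d = 2 ℕ.^ n
  D = 2 ℕ.^ suc n
  instance
    d≢0 : NonZero d
    d≢0 = ℕ.m^n≢0 2 n
    D≢0 : NonZero D
    D≢0 = ℕ.m^n≢0 2 (suc n)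
    DD≢0 : NonZero (D ℕ.* D)
    DD≢0 = ℕ.m*n≢0 D D

2^-antitone : ∀ {m n} → m ℕ.≤ n → 2^- n ≤ 2^- m
2^-antitone {m} {n} m≤n = /-≤ 1 (2 ℕ.^ n) 1 (2 ℕ.^ m) {{ℕ.m^n≢0 2 n}} {{ℕ.m^n≢0 2 m}}
  (ℕ.*-monoʳ-≤ 1 (ℕ.^-monoʳ-≤ 2 m≤n))

-- An opaque copy of 2^-_, which keeps Agda from unfolding the fractions.
opaque
  infix 9 ½^_
  ½^_ : ℕ → ℚ
  ½^ n = 2^- n

  ½^≡2^- : ∀ n → ½^ n ≡ 2^- n
  ½^≡2^- n = refl

  ½^-positive : ∀ n → 0ℚ < ½^ n
  ½^-positive = 2^-positive

  ½^-double : ∀ n → ½^ suc n + ½^ suc n ≡ ½^ n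
  ½^-double = 2^-double

  ½^-antitone : ∀ {m n} → m ℕ.≤ n → ½^ n ≤ ½^ m
  ½^-antitone = 2^-antitone

½^-nonneg : ∀ n → 0ℚ ≤ ½^ n
½^-nonneg n = <⇒≤ (½^-positive n)

infixl 7 _·_
_·_ : ℕ → ℚ → ℚ
zero  · q = 0ℚ
suc n · q = q + n · q

·-+ : ∀ m n q → (m ℕ.+ n) · q ≡ m · q + n · q
·-+ zero    n q = sym (+-identityˡ (n · q))
·-+ (suc m) n q = trans (cong (q +_) (·-+ m n q)) (sym (+-assoc q (m · q) (n · q)))

·-nonneg : ∀ n {q} → 0ℚ ≤ q → 0ℚ ≤ n · q
·-nonneg zero    0≤q = ≤-refl
·-nonneg (suc n) 0≤q = +-mono-≤ 0≤q (·-nonneg n 0≤q)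

2^n·½^n : ∀ k n → (2 ℕ.^ n) · (½^ (k ℕ.+ n)) ≡ ½^ k
2^n·½^n k zero    = trans (+-identityʳ _) (cong ½^_ (ℕ.+-identityʳ k))
2^n·½^n k (suc n) = begin
  (2 ℕ.^ suc n) · (½^ (k ℕ.+ suc n))                  ≡⟨ cong (λ m → (2 ℕ.^ suc n) · (½^ m)) (ℕ.+-suc k n) ⟩
  (2 ℕ.^ n ℕ.+ (2 ℕ.^ n ℕ.+ 0)) · q                    ≡⟨ cong (λ m → (2 ℕ.^ n ℕ.+ m) · q) (ℕ.+-identityʳ (2 ℕ.^ n)) ⟩
  (2 ℕ.^ n ℕ.+ 2 ℕ.^ n) · q                            ≡⟨ ·-+ (2 ℕ.^ n) (2 ℕ.^ n) q ⟩
  (2 ℕ.^ n) · q + (2 ℕ.^ n) · q                        ≡⟨ cong₂ _+_ (2^n·½^n (suc k) n) (2^n·½^n (suc k) n) ⟩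
  ½^ suc k + ½^ suc k                                ≡⟨ ½^-double k ⟩
  ½^ k                                                ∎
  where
  open ≡-Reasoning
  q = ½^ (suc k ℕ.+ n)

n<2^n : ∀ n → n ℕ.< 2 ℕ.^ n
n<2^n zero    = s≤s z≤n
n<2^n (suc n) = ℕ.≤-trans (s≤s (n<2^n n)) (ℕ.+-mono-≤ {1} (ℕ.m^n>0 2 n) (ℕ.m≤m+n (2 ℕ.^ n) 0))

archimedean : ∀ {ε} → 0ℚ < ε → ∃ λ n → 2^- n ≤ ε
archimedean {ε@(ℚ.mkℚ (ℤ.+ zero) d _)} 0<ε = contradiction (ℚ.drop-*<* 0<ε) (ℤ.<-irrefl refl)
-- A positive ε has numerator at least 1, and its denominator d + 1 is below 2^(d + 1).
archimedean {ε@(ℚ.mkℚ (ℤ.+ suc a) d _)} 0<ε = suc d , subst (2^- suc d ≤_) (fromℚᵘ-toℚᵘ ε)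
  (/-≤ 1 (2 ℕ.^ suc d) (suc a) (suc d) {{ℕ.m^n≢0 2 (suc d)}} (begin
    1 ℕ.* suc d                  ≡⟨ ℕ.*-identityˡ (suc d) ⟩
    suc d                        ≤⟨ ℕ.<⇒≤ (n<2^n (suc d)) ⟩
    2 ℕ.^ suc d                  ≤⟨ ℕ.m≤m+n (2 ℕ.^ suc d) (a ℕ.* 2 ℕ.^ suc d) ⟩
    suc a ℕ.* 2 ℕ.^ suc d        ∎))
  where open ℕ.≤-Reasoning
archimedean {ε@(ℚ.mkℚ ℤ.-[1+ _ ] d _)} 0<ε = contradiction (ℚ.drop-*<* 0<ε) λ ()

-- The tree construction and its potentials

amount : Maybe ℕ → ℚ
amount nothing  = 0ℚ
amount (just k) = ½^ k

amount-nonneg : ∀ o → 0ℚ ≤ amount o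
amount-nonneg nothing  = ≤-refl
amount-nonneg (just k) = ½^-nonneg k

-- In node w a l c k q A B, the node was created at stage w, a tells whether
-- its request was made, l is the stage of its last expansion, and c pieces
-- of size ½^(k + q) remain of the increment that A issued at stage q.  A is
-- the child guessing infinitely many expansions, B the one guessing finitely
-- many.
data Tree : Set where
  leaf : Tree
  node : (w : ℕ) (a : Bool) (l c k q : ℕ) (A B : Tree) → Tree

-- A request takes precedence and resets the node, so that at most one increment leaves a node per
-- stage. Increments from B pass unsliced, because under its guess there are only finitely many
-- expansions to wait for.
resolve : (t w : ℕ) (a : Bool) (l c k q : ℕ) (A B : Tree) → Bool → Bool → Tree × Maybe ℕ → Tree × Maybe ℕ
resolve t w a l c       k q A B true  _     _             = node w true l 0 0 0 leaf leaf , just (2 ℕ.+ w)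
resolve t w a l c       k q A B false false (B′ , o)       = node w a l c k q A B′ , o
resolve t w a l (suc c) k q A B false true  _             = node w a t c k q A leaf , just (k ℕ.+ q)
-- The stage is updated even though nothing is queued; this keeps `stageOf` growing when A stays
-- silent.
resolve t w a l zero    k q A B false true  (A′ , nothing) = node w a t 0 0 t A′ leaf , nothing
resolve t w a l zero    k q A B false true  (A′ , just k′) = node w a t (2 ℕ.^ t) k′ t A′ leaf , nothing

-- μ bounds what a tree can still output without creating new nodes.
μ : Tree → ℚ
μ leaf = 0ℚ
μ (node w a l c k q A B) = (if a then 0ℚ else ½^ (2 ℕ.+ w)) + c · (½^ (k ℕ.+ q)) + (μ A + μ B)

request-nonneg : ∀ a w → 0ℚ ≤ (if a then 0ℚ else ½^ (2 ℕ.+ w))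
request-nonneg true  w = ≤-refl
request-nonneg false w = ½^-nonneg (2 ℕ.+ w)

pending-nonneg : ∀ c n → 0ℚ ≤ c · (½^ n)
pending-nonneg c n = ·-nonneg c (½^-nonneg n)

μ-nonneg : ∀ S → 0ℚ ≤ μ S
μ-nonneg leaf = ≤-refl
μ-nonneg (node w a l c k q A B) =
  +-mono-≤ (+-mono-≤ (request-nonneg a w) (pending-nonneg c (k ℕ.+ q))) (+-mono-≤ (μ-nonneg A) (μ-nonneg B))

data Guess : Set where
  infinite finite : Guess

Path : Set
Path = List Guess

module Construction (conv : ℕ → ℕ → ℕ → Bool) where

  acts : (e t w : ℕ) → Bool → Bool
  acts e t w a = not a ∧ conv e (2 ℕ.+ w) t

  -- Asking for the value at l + 1 ensures that a window of an increasing s contains at most one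
  -- expansion.
  expands : (e t l : ℕ) → Bool
  expands e t l = conv e (suc l) t

  step : ℕ → ℕ → Tree → Tree × Maybe ℕ
  step e t leaf = node t false t 0 0 0 leaf leaf , nothing
  step e t (node w a l c k q A B) =
    resolve t w a l c k q A B (acts e t w a) (expands e t l)
      (if expands e t l then step (suc e) t A else step (suc e) t B)

  next : ℕ → ℕ → Tree → Tree
  next e t S = proj₁ (step e t S)

  out : ℕ → ℕ → Tree → ℚ
  out e t S = amount (proj₂ (step e t S))

  out-nonneg : ∀ e t S → 0ℚ ≤ out e t S
  out-nonneg e t S = amount-nonneg (proj₂ (step e t S))

  -- A stage follows a single path and creates at most one node, whose request is the only new
  -- potential. All else is output, turned into pieces of the same total, kept or discarded.
  μ-step : ∀ e t S → out e t S + μ (next e t S) ≤ μ S + ½^ (2 ℕ.+ t)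
  μ-step e t leaf = ≤-reflexive
    (rearrange₁ (½^ (2 ℕ.+ t)))
  μ-step e t (node w a l c k q A B) with acts e t w a in act | expands e t l
  μ-step e t (node w false l c k q A B) | true | _ =
    linear (+-mono-≤ (+-mono-≤ (pending-nonneg c (k ℕ.+ q)) (+-mono-≤ (μ-nonneg A) (μ-nonneg B)))
                     (½^-nonneg (2 ℕ.+ t)))
      (rearrange₂ (½^ (2 ℕ.+ w)) (c · (½^ (k ℕ.+ q))) (μ A) (μ B) (½^ (2 ℕ.+ t)))
  μ-step e t (node w a l (suc c) k q A B) | false | true =
    linear (+-mono-≤ (μ-nonneg B) (½^-nonneg (2 ℕ.+ t)))
      (rearrange₃ (if a then 0ℚ else ½^ (2 ℕ.+ w)) (½^ (k ℕ.+ q)) (c · (½^ (k ℕ.+ q))) (μ A) (μ B) (½^ (2 ℕ.+ t)))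
  μ-step e t (node w a l zero k q A B) | false | true with step (suc e) t A | μ-step (suc e) t A
  ... | A′ , nothing | ih =
    linear (+-mono-≤ ih (μ-nonneg B))
      (rearrange₄ (if a then 0ℚ else ½^ (2 ℕ.+ w)) (μ A′) (μ A) (μ B) (½^ (2 ℕ.+ t)))
  ... | A′ , just k′ | ih rewrite 2^n·½^n k′ t =
    linear (+-mono-≤ ih (μ-nonneg B))
      (rearrange₅ (if a then 0ℚ else ½^ (2 ℕ.+ w)) (½^ k′) (μ A′) (μ A) (μ B) (½^ (2 ℕ.+ t)))
  μ-step e t (node w a l c k q A B) | false | false with step (suc e) t B | μ-step (suc e) t B
  ... | B′ , o | ih =
    linear ih
      (rearrange₆ (if a then 0ℚ else ½^ (2 ℕ.+ w)) (c · (½^ (k ℕ.+ q))) (μ A) (μ B′) (μ B) (½^ (2 ℕ.+ t)) (amount o))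

  -- At t p e S e′ S′: the step at stage t visits the node S′ at the end of the
  -- path p from S, and no node before S′ makes a request.
  data At (t : ℕ) : Path → (e : ℕ) → Tree → (e′ : ℕ) → Tree → Set where
    here : ∀ {e S} → At t [] e S e S
    inf  : ∀ {p e w a l k q A B e′ S′} → acts e t w a ≡ false → expands e t l ≡ true →
           At t p (suc e) A e′ S′ → At t (infinite ∷ p) e (node w a l 0 k q A B) e′ S′
    fin  : ∀ {p e w a l c k q A B e′ S′} → acts e t w a ≡ false → expands e t l ≡ false →
           At t p (suc e) B e′ S′ → At t (finite ∷ p) e (node w a l c k q A B) e′ S′

  -- The step at stage t leaves the node at the end of the path untouched.
  data Off (t : ℕ) : Path → (e : ℕ) → Tree → Set where
    wait : ∀ {p e w a l c k q A B} → acts e t w a ≡ false → expands e t l ≡ false →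
           Off t (infinite ∷ p) e (node w a l c k q A B)
    emit : ∀ {p e w a l c k q A B} → acts e t w a ≡ false → expands e t l ≡ true →
           Off t (infinite ∷ p) e (node w a l (suc c) k q A B)
    inf  : ∀ {p e w a l k q A B} → acts e t w a ≡ false → expands e t l ≡ true →
           Off t p (suc e) A → Off t (infinite ∷ p) e (node w a l 0 k q A B)
    fin  : ∀ {p e w a l c k q A B} → acts e t w a ≡ false → expands e t l ≡ false →
           Off t p (suc e) B → Off t (finite ∷ p) e (node w a l c k q A B)

  sub : Path → Tree → Tree
  sub []             S                       = S
  sub (_ ∷ _)        leaf                    = leaf
  sub (infinite ∷ p) (node w a l c k q A B)  = sub p A
  sub (finite ∷ p)   (node w a l c k q A B)  = sub p B

  sub-leaf : ∀ p → sub p leaf ≡ leaf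
  sub-leaf []      = refl
  sub-leaf (_ ∷ _) = refl

  sub-++ : ∀ p p′ S → sub (p ++ p′) S ≡ sub p′ (sub p S)
  sub-++ []             p′ S    = refl
  sub-++ (_ ∷ p)        p′ leaf = sym (sub-leaf p′)
  sub-++ (infinite ∷ p) p′ (node w a l c k q A B) = sub-++ p p′ A
  sub-++ (finite ∷ p)   p′ (node w a l c k q A B) = sub-++ p p′ B

  module _ {t : ℕ} where

    At-++ : ∀ {p p′ e S e′ S′ e″ S″} → At t p e S e′ S′ → At t p′ e′ S′ e″ S″ → At t (p ++ p′) e S e″ S″
    At-++ here        v = v
    At-++ (inf x y u) v = inf x y (At-++ u v)
    At-++ (fin x y u) v = fin x y (At-++ u v)

    At-Off : ∀ {p p′ e S e′ S′} → At t p e S e′ S′ → Off t p′ e′ S′ → Off t (p ++ p′) e S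
    At-Off here        v = v
    At-Off (inf x y u) v = inf x y (At-Off u v)
    At-Off (fin x y u) v = fin x y (At-Off u v)

    Off-++ : ∀ {p p′ e S} → Off t p e S → Off t (p ++ p′) e S
    Off-++ (wait x y)  = wait x y
    Off-++ (emit x y)  = emit x y
    Off-++ (inf x y u) = inf x y (Off-++ u)
    Off-++ (fin x y u) = fin x y (Off-++ u)

    At-sub : ∀ {p e S e′ S′} → At t p e S e′ S′ → sub p S ≡ S′
    At-sub here        = refl
    At-sub (inf _ _ u) = At-sub u
    At-sub (fin _ _ u) = At-sub u

    At-next : ∀ {p e S e′ S′} → At t p e S e′ S′ → sub p (next e t S) ≡ next e′ t S′
    At-next here = refl
    At-next (inf {e = e} {A = A} x y u) rewrite x | y with step (suc e) t A | At-next u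
    ... | _ , nothing | eq = eq
    ... | _ , just _  | eq = eq
    At-next (fin x y u) rewrite x | y = At-next u

    Off-next : ∀ {p e S} → Off t p e S → sub p (next e t S) ≡ sub p S
    Off-next (wait x y) rewrite x | y = refl
    Off-next (emit x y) rewrite x | y = refl
    Off-next (inf {e = e} {A = A} x y u) rewrite x | y with step (suc e) t A | Off-next u
    ... | _ , nothing | eq = eq
    ... | _ , just _  | eq = eq
    Off-next (fin x y u) rewrite x | y = Off-next u

  -- The potential outside the node at the end of a path (weighted by f),
  -- when the subtrees branching off to finite guesses are weighted by g.
  module Potential (f g : Tree → ℚ) where

    pot : Path → Tree → ℚ
    pot []             S                      = f S
    pot (_ ∷ _)        leaf                   = 0ℚ
    pot (infinite ∷ p) (node w a l c k q A B) = c · (½^ (k ℕ.+ q)) + pot p A + g B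
    -- An expansion here would discard the path, so while `At` or `Off` holds the pieces and A are
    -- dormant and count for nothing.
    pot (finite ∷ p)   (node w a l c k q A B) = pot p B

    -- An exact balance: at each infinite guess the visit finds no pieces and replaces B by a leaf,
    -- so the old side potential disappears, and an increment from below is either passed on or
    -- queued in full.
    At-pot : g leaf ≡ 0ℚ → ∀ {t p e S e′ S′} → At t p e S e′ S′ →
             out e t S + pot p (next e t S) ≡ out e′ t S′ + f (next e′ t S′)
    At-pot g≡0 here = refl
    At-pot g≡0 {t} (inf {p} {e} {A = A} x y u) rewrite x | y with step (suc e) t A | At-pot g≡0 u
    ... | A′ , nothing | ih rewrite g≡0 = trans
      (rearrange₇ (pot p A′)) ih
    ... | A′ , just k  | ih rewrite g≡0 | 2^n·½^n k t = trans
      (rearrange₈ (½^ k) (pot p A′)) ih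
    At-pot g≡0 (fin x y u) rewrite x | y = At-pot g≡0 u

  module Upper (f : Tree → ℚ) where
    open Potential f μ public

    -- Leaving the path means either stepping one side subtree, where `μ-step` applies, or releasing
    -- a piece that was already counted.
    Off-pot : ∀ {t p e S} → Off t p e S → out e t S + pot p (next e t S) ≤ pot p S + ½^ (2 ℕ.+ t)
    Off-pot {t} {S = node w a l c k q A B} (wait {p} {e} {c = c} x y) rewrite x | y
      with step (suc e) t B | μ-step (suc e) t B
    ... | B′ , o | ih = linear ih
      (rearrange₉ (amount o) (c · (½^ (k ℕ.+ q))) (pot p A) (μ B′) (μ B) (½^ (2 ℕ.+ t)))
    Off-pot {t} (emit {p} {c = c} {k} {q} {A} {B} x y) rewrite x | y =
      linear (+-mono-≤ (μ-nonneg B) (½^-nonneg (2 ℕ.+ t)))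
        (rearrange₁₀ (½^ (k ℕ.+ q)) (c · (½^ (k ℕ.+ q))) (pot p A) (μ B) (½^ (2 ℕ.+ t)))
    Off-pot {t} (inf {p} {e} {A = A} {B} x y u) rewrite x | y with step (suc e) t A | Off-pot u
    ... | A′ , nothing | ih = linear (+-mono-≤ ih (μ-nonneg B))
      (rearrange₁₁ (pot p A′) (pot p A) (μ B) (½^ (2 ℕ.+ t)))
    ... | A′ , just k | ih rewrite 2^n·½^n k t = linear (+-mono-≤ ih (μ-nonneg B))
      (rearrange₁₂ (½^ k) (pot p A′) (pot p A) (μ B) (½^ (2 ℕ.+ t)))
    Off-pot (fin x y u) rewrite x | y = Off-pot u

    At-pot-≥ : ∀ {t p e S e′ S′} → At t p e S e′ S′ → f S′ ≤ pot p S
    At-pot-≥ here = ≤-refl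
    At-pot-≥ (inf {p} {A = A} {B} {S′ = S′} x y u) =
      linear (+-mono-≤ (At-pot-≥ u) (μ-nonneg B)) (rearrange₁₃ (f S′) (pot p A) (μ B))
    At-pot-≥ (fin x y u) = At-pot-≥ u

    pot-nonneg : (∀ S → 0ℚ ≤ f S) → ∀ p S → 0ℚ ≤ pot p S
    pot-nonneg f≥0 []             S    = f≥0 S
    pot-nonneg f≥0 (_ ∷ p)        leaf = ≤-refl
    pot-nonneg f≥0 (infinite ∷ p) (node w a l c k q A B) =
      +-mono-≤ (+-mono-≤ (pending-nonneg c (k ℕ.+ q)) (pot-nonneg f≥0 p A)) (μ-nonneg B)
    pot-nonneg f≥0 (finite ∷ p)   (node w a l c k q A B) = pot-nonneg f≥0 p B

-- The evolution of the tree and the true path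

from-induction : (P : ℕ → Set) → ∀ {m} → P m → (∀ {t} → m ℕ.≤ t → P t → P (suc t)) → ∀ {t} → m ℕ.≤ t → P t
from-induction P {m} base ih {t} m≤t with ℕ.m≤n⇒m<n∨m≡n m≤t
from-induction P         base ih {t}     m≤t | inj₂ refl       = base
from-induction P         base ih {suc t} m≤t | inj₁ (s≤s m≤t′) = ih m≤t′ (from-induction P base ih m≤t′)

infinitely-often : ExcludedMiddle 0ℓ → (P : ℕ → Set) →
                   (∀ m → ∃ λ t → m ℕ.≤ t × P t) ⊎ (∃ λ m → ∀ {t} → m ℕ.≤ t → ¬ P t)
infinitely-often em P with em {∃ λ m → ∀ t → m ℕ.≤ t → ¬ P t}
... | yes (m , none) = inj₂ (m , λ {t} → none t)
... | no unbounded = inj₁ later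
  where
  later : ∀ m → ∃ λ t → m ℕ.≤ t × P t
  later m with em {∃ λ t → m ℕ.≤ t × P t}
  ... | yes found = found
  ... | no none   = contradiction (m , λ t m≤t pt → none (t , m≤t , pt)) unbounded

module Dynamics (conv : ℕ → ℕ → ℕ → Bool) where
  open Construction conv

  tree : ℕ → Tree
  tree zero    = leaf
  tree (suc t) = next 0 t (tree t)

  x : ℕ → ℚ
  x zero    = 0ℚ
  x (suc t) = x t + out 0 t (tree t)

  x-mono-suc : ∀ t → x t ≤ x (suc t)
  x-mono-suc t = subst (_≤ x (suc t)) (+-identityʳ (x t)) (+-monoʳ-≤ (x t) (out-nonneg 0 t (tree t)))

  x-mono : ∀ {s t} → s ℕ.≤ t → x s ≤ x t
  x-mono {s} = from-induction (λ t → x s ≤ x t) ≤-refl (λ {t} _ le → ≤-trans le (x-mono-suc t))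

  at : Path → ℕ → Tree
  at p t = sub p (tree t)

  Visit : Path → ℕ → ℕ → Set
  Visit p j t = At t p 0 (tree t) j (at p t)

  Skip : Path → ℕ → Set
  Skip p t = Off t p 0 (tree t)

  visit : ∀ {t p j S} → At t p 0 (tree t) j S → Visit p j t
  visit {t} {p} {j} v = subst (At t p 0 (tree t) j) (sym (At-sub v)) v

  -- From stage R on, p is an initial part of the true path. `stable` excludes the stages that would
  -- discard its end: a request by an ancestor, or an expansion above a finite guess.
  record Live (p : Path) (j R : ℕ) : Set where
    field
      fresh  : at p R ≡ leaf
      stable : ∀ {t} → R ℕ.≤ t → Visit p j t ⊎ Skip p t
      often  : ∀ m → ∃ λ t → m ℕ.≤ t × Visit p j t

  record FirstVisit (p : Path) (j R : ℕ) : Set where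
    field
      {r}     : ℕ
      R≤r     : R ℕ.≤ r
      visited : Visit p j r
      empty   : at p r ≡ leaf

    created : at p (suc r) ≡ node r false r 0 0 0 leaf leaf
    created = trans (At-next visited) (cong (next j r) empty)

  first-visit : ∀ {p j R} → Live p j R → FirstVisit p j R
  first-visit {p} {j} {R} live with t , R≤t , v ← Live.often live R =
    go (t ℕ.∸ R) ℕ.≤-refl (Live.fresh live) (subst (Visit p j) (sym (ℕ.m∸n+n≡m R≤t)) v)
    where
    go : ∀ d {s} → R ℕ.≤ s → at p s ≡ leaf → Visit p j (d ℕ.+ s) → FirstVisit p j R
    go zero    R≤s eq v = record { R≤r = R≤s ; visited = v ; empty = eq }
    go (suc d) {s} R≤s eq v with Live.stable live R≤s
    ... | inj₁ u = record { R≤r = R≤s ; visited = u ; empty = eq }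
    ... | inj₂ o = go d (ℕ.m≤n⇒m≤1+n R≤s) (trans (Off-next o) eq) (subst (Visit p j) (sym (ℕ.+-suc d s)) v)

  acting expanding : ℕ → ℕ → Tree → Bool
  acting j t leaf = false
  acting j t (node w a l c k q A B) = acts j t w a
  expanding j t leaf = false
  expanding j t (node w a l c k q A B) = expands j t l

  pending : Tree → ℕ
  pending leaf = 0
  pending (node w a l c k q A B) = c

  -- How the node at the end of p changes at stage t, once it makes no requests.
  data Evolution (p : Path) (j t : ℕ) : Tree → Tree → Set where
    skip  : ∀ {S} → Skip p t → Evolution p j t S S
    pass  : ∀ {w a l c k q A B} → Visit p j t → acts j t w a ≡ false → expands j t l ≡ false →
            Evolution p j t (node w a l c k q A B) (node w a l c k q A (next (suc j) t B))
    piece : ∀ {w a l c k q A B} → Visit p j t → acts j t w a ≡ false → expands j t l ≡ true →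
            Evolution p j t (node w a l (suc c) k q A B) (node w a t c k q A leaf)
    pull  : ∀ {w a l c k q A B A′ c′ k′} → Visit p j t → acts j t w a ≡ false → expands j t l ≡ true → c ≡ 0 →
            Evolution p j t (node w a l c k q A B) (node w a t c′ k′ t A′ leaf)

  -- A node settles either right after its creation or right after its only request; both leave it
  -- without children, pieces or a recorded stage.
  record Settled (p : Path) (j R : ℕ) : Set where
    field
      start    : ∃ λ w → ∃ λ a → ∃ λ l → at p R ≡ node w a l 0 0 0 leaf leaf
      stable   : ∀ {t} → R ℕ.≤ t → Visit p j t ⊎ Skip p t
      often    : ∀ m → ∃ λ t → m ℕ.≤ t × Visit p j t
      no-acts  : ∀ {t} → R ℕ.≤ t → Visit p j t → acting j t (at p t) ≡ false

  data IsNode : Tree → Set where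
    node : ∀ {w a l c k q A B} → IsNode (node w a l c k q A B)

  next-node : ∀ j t S → IsNode (next j t S)
  next-node j t leaf = node
  next-node j t (node w a l c k q A B) with acts j t w a | expands j t l
  ... | true  | _     = node
  ... | false | false = node
  next-node j t (node w a l (suc c) k q A B) | false | true = node
  next-node j t (node w a l zero k q A B)    | false | true with step (suc j) t A
  ... | _ , nothing = node
  ... | _ , just _  = node

  data Requested : Tree → Set where
    requested : ∀ {w l c k q A B} → Requested (node w true l c k q A B)

  next-requested : ∀ j t {S} → Requested S → Requested (next j t S)
  next-requested j t (requested {w} {l} {zero} {k} {q} {A} {B}) with expands j t l
  ... | false = requested
  ... | true with step (suc j) t A
  ... | _ , nothing = requested
  ... | _ , just _  = requested
  next-requested j t (requested {w} {l} {suc c} {k} {q} {A} {B}) with expands j t l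
  ... | false = requested
  ... | true = requested

  module _ {p : Path} {j R : ℕ} (settled : Settled p j R) where
    open Settled settled

    is-node : ∀ {t} → R ℕ.≤ t → IsNode (at p t)
    is-node = from-induction (λ t → IsNode (at p t)) base ih
      where
      base : IsNode (at p R)
      base with _ , _ , _ , eq ← start rewrite eq = node
      ih : ∀ {t} → R ℕ.≤ t → IsNode (at p t) → IsNode (at p (suc t))
      ih {t} R≤t nd with stable R≤t
      ... | inj₁ v rewrite At-next v = next-node j t (at p t)
      ... | inj₂ o rewrite Off-next o = nd

    evolve : ∀ {t} → R ℕ.≤ t → Evolution p j t (at p t) (at p (suc t))
    evolve {t} R≤t with stable R≤t
    ... | inj₂ o rewrite Off-next o = skip o
    ... | inj₁ v rewrite At-next v = evolve-visit (is-node R≤t) v (no-acts R≤t v)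
      where
      evolve-visit : ∀ {S} → IsNode S → Visit p j t → acting j t S ≡ false → Evolution p j t S (next j t S)
      evolve-visit (node {w} {a} {l} {c} {k} {q} {A} {B}) v act with expands j t l in exp
      ... | false rewrite act = pass v act exp
      evolve-visit (node {w} {a} {l} {suc c} {k} {q} {A} {B}) v act | true rewrite act = piece v act exp
      evolve-visit (node {w} {a} {l} {zero} {k} {q} {A} {B}) v act | true rewrite act with step (suc j) t A
      ... | _ , nothing = pull v act exp refl
      ... | _ , just _  = pull v act exp refl

    Expansion : ℕ → Set
    Expansion t = Visit p j t × expanding j t (at p t) ≡ true

    Pull : ℕ → Set
    Pull t = Expansion t × pending (at p t) ≡ 0

    -- An expansion with pieces in the queue removes one, and only a pull refills the queue. The
    -- induction is on a bound n for the queue and, within it, on the distance d to a known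
    -- expansion.
    pulls : (∀ m → ∃ λ t → m ℕ.≤ t × Expansion t) → ∀ m → ∃ λ t → m ℕ.≤ t × Pull t
    pulls often-expands m with from-leftover (pending (at p (R ℕ.⊔ m))) (ℕ.m≤m⊔n R m) ℕ.≤-refl
      where
      from-leftover : ∀ n {t} → R ℕ.≤ t → pending (at p t) ℕ.≤ n → ∃ λ u → t ℕ.≤ u × Pull u
      shift : ∀ {t} → (∃ λ u → suc t ℕ.≤ u × Pull u) → ∃ λ u → t ℕ.≤ u × Pull u
      shift (u , le , pulled) = u , ℕ.<⇒≤ le , pulled
      expand-now : ∀ n {t S} → R ℕ.≤ t → at p t ≡ S → IsNode S → Visit p j t → acting j t S ≡ false →
                   expanding j t S ≡ true → pending S ℕ.≤ n → ∃ λ u → t ℕ.≤ u × Pull u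
      expand-now n {t} R≤t eq (node {c = zero}) v act exp le =
        t , ℕ.≤-refl , (v , trans (cong (expanding j t) eq) exp) , cong pending eq
      expand-now (suc n) {t} R≤t eq (node {w} {a} {l} {suc c} {k} {q} {A} {B}) v act exp le =
        shift (from-leftover n (ℕ.m≤n⇒m≤1+n R≤t) (subst (λ S → pending S ℕ.≤ n) (sym piece-left) (s≤s⁻¹ le)))
        where
        emitted : next j t (node w a l (suc c) k q A B) ≡ node w a t c k q A leaf
        emitted rewrite act | exp = refl
        piece-left : at p (suc t) ≡ node w a t c k q A leaf
        piece-left = trans (At-next v) (trans (cong (next j t) eq) emitted)
      walk : ∀ n d {t} → R ℕ.≤ t → pending (at p t) ℕ.≤ n → Expansion (d ℕ.+ t) → ∃ λ u → t ℕ.≤ u × Pull u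
      walk-step : ∀ n d {t S S′} → R ℕ.≤ t → at p t ≡ S → at p (suc t) ≡ S′ → Evolution p j t S S′ →
                  pending S ℕ.≤ n → Expansion (suc d ℕ.+ t) → ∃ λ u → t ℕ.≤ u × Pull u
      walk n zero    R≤t le (v , exp) = expand-now n R≤t refl (is-node R≤t) v (no-acts R≤t v) exp le
      walk n (suc d) R≤t le e         = walk-step n d R≤t refl refl (evolve R≤t) le e
      walk-step n d {t} R≤t eq eq′ (skip _) le e =
        shift (walk n d (ℕ.m≤n⇒m≤1+n R≤t) (subst (λ S → pending S ℕ.≤ n) (sym eq′) le)
                (subst Expansion (sym (ℕ.+-suc d t)) e))
      walk-step n d {t} R≤t eq eq′ (pass _ _ _) le e =
        shift (walk n d (ℕ.m≤n⇒m≤1+n R≤t) (subst (λ S → pending S ℕ.≤ n) (sym eq′) le)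
                (subst Expansion (sym (ℕ.+-suc d t)) e))
      walk-step n d R≤t eq eq′ (piece v act exp)     le e = expand-now n R≤t eq node v act exp le
      walk-step n d R≤t eq eq′ (pull v act exp refl) le e = expand-now n R≤t eq node v act exp le
      from-leftover n {t} R≤t le with u , t≤u , e ← often-expands t =
        walk n (u ℕ.∸ t) R≤t le (subst Expansion (sym (ℕ.m∸n+n≡m t≤u)) e)
    ... | t , le , pulled = t , ℕ.≤-trans (ℕ.m≤n⊔m R m) le , pulled

    pull-visit : ∀ {t} → R ℕ.≤ t → Pull t → Visit (p ++ infinite ∷ []) (suc j) t
    pull-visit {t} R≤t ((v , exp) , c≡0) = from-pull (is-node R≤t) v (no-acts R≤t v) exp c≡0
      where
      from-pull : ∀ {S} → IsNode S → At t p 0 (tree t) j S → acting j t S ≡ false → expanding j t S ≡ true →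
                  pending S ≡ 0 → Visit (p ++ infinite ∷ []) (suc j) t
      from-pull node v act exp refl = visit (At-++ v (inf act exp here))

    live-infinite : (∀ m → ∃ λ t → m ℕ.≤ t × Expansion t) → Live (p ++ infinite ∷ []) (suc j) R
    live-infinite often-expands = record
      { fresh = fresh ; stable = stable′ ; often = often′ }
      where
      often′ : ∀ m → ∃ λ t → m ℕ.≤ t × Visit (p ++ infinite ∷ []) (suc j) t
      often′ m with t , le , pulled ← pulls often-expands (R ℕ.⊔ m) =
        t , ℕ.≤-trans (ℕ.m≤n⊔m R m) le , pull-visit (ℕ.≤-trans (ℕ.m≤m⊔n R m) le) pulled
      fresh : at (p ++ infinite ∷ []) R ≡ leaf
      fresh with _ , _ , _ , eq ← start rewrite sub-++ p (infinite ∷ []) (tree R) | eq = refl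
      stable′ : ∀ {t} → R ℕ.≤ t → Visit (p ++ infinite ∷ []) (suc j) t ⊎ Skip (p ++ infinite ∷ []) t
      stable′ {t} R≤t with stable R≤t
      ... | inj₂ o = inj₂ (Off-++ o)
      ... | inj₁ v = from-visit (is-node R≤t) v (no-acts R≤t v)
        where
        from-visit : ∀ {S} → IsNode S → At t p 0 (tree t) j S → acting j t S ≡ false →
                     Visit (p ++ infinite ∷ []) (suc j) t ⊎ Skip (p ++ infinite ∷ []) t
        from-visit (node {l = l}) v act with expands j t l in exp
        from-visit (node)             v act | false = inj₂ (At-Off v (wait act exp))
        from-visit (node {c = zero})  v act | true  = inj₁ (visit (At-++ v (inf act exp here)))
        from-visit (node {c = suc _}) v act | true  = inj₂ (At-Off v (emit act exp))

    live-finite : ∀ {R′} → R ℕ.≤ R′ → at (p ++ finite ∷ []) R′ ≡ leaf → (∀ {t} → R′ ℕ.≤ t → ¬ Expansion t) →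
                  Live (p ++ finite ∷ []) (suc j) R′
    live-finite {R′} R≤R′ fresh no-exp = record { fresh = fresh ; stable = stable′ ; often = often′ }
      where
      visits : ∀ {t} → R′ ℕ.≤ t → Visit p j t → Visit (p ++ finite ∷ []) (suc j) t
      visits {t} R′≤t v =
        from-visit (is-node (ℕ.≤-trans R≤R′ R′≤t)) v (no-acts (ℕ.≤-trans R≤R′ R′≤t) v)
          (λ exp → no-exp R′≤t (v , exp))
        where
        from-visit : ∀ {S} → IsNode S → At t p 0 (tree t) j S → acting j t S ≡ false →
                     ¬ expanding j t S ≡ true → Visit (p ++ finite ∷ []) (suc j) t
        from-visit (node {l = l}) v act ¬exp with expands j t l in exp
        ... | false = visit (At-++ v (fin act exp here))
        ... | true  = contradiction refl ¬exp
      stable′ : ∀ {t} → R′ ℕ.≤ t → Visit (p ++ finite ∷ []) (suc j) t ⊎ Skip (p ++ finite ∷ []) t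
      stable′ R′≤t with stable (ℕ.≤-trans R≤R′ R′≤t)
      ... | inj₁ v = inj₁ (visits R′≤t v)
      ... | inj₂ o = inj₂ (Off-++ o)
      often′ : ∀ m → ∃ λ t → m ℕ.≤ t × Visit (p ++ finite ∷ []) (suc j) t
      often′ m with t , le , v ← often (R′ ℕ.⊔ m) =
        t , ℕ.≤-trans (ℕ.m≤n⊔m R′ m) le , visits (ℕ.≤-trans (ℕ.m≤m⊔n R′ m) le) v

    -- The search runs backwards from m. The last expansion discards the finite subtree, so it is
    -- empty just afterwards; if the search reaches R, it is still the empty one of the settled
    -- start.
    last-expansion : ∀ m → (∀ {t} → m ℕ.≤ t → ¬ Expansion t) →
                     ∃ λ R′ → R ℕ.≤ R′ × at (p ++ finite ∷ []) R′ ≡ leaf × (∀ {t} → R′ ℕ.≤ t → ¬ Expansion t)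
    last-expansion m no-exp with m ℕ.≤? R
    ... | yes m≤R = R , ℕ.≤-refl , fresh , λ R≤t → no-exp (ℕ.≤-trans m≤R R≤t)
      where
      fresh : at (p ++ finite ∷ []) R ≡ leaf
      fresh with _ , _ , _ , eq ← start rewrite sub-++ p (finite ∷ []) (tree R) | eq = refl
    last-expansion zero    no-exp | no m≰R = contradiction z≤n m≰R
    last-expansion (suc m) no-exp | no m≰R = decide (stable R≤m)
      where
      R≤m : R ℕ.≤ m
      R≤m = s≤s⁻¹ (ℕ.≰⇒> m≰R)
      extend : ¬ Expansion m → ∀ {t} → m ℕ.≤ t → ¬ Expansion t
      extend ¬e {t} m≤t with ℕ.m≤n⇒m<n∨m≡n m≤t
      ... | inj₁ m<t  = no-exp m<t
      ... | inj₂ refl = ¬e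
      Result : Set
      Result = ∃ λ R′ → R ℕ.≤ R′ × at (p ++ finite ∷ []) R′ ≡ leaf × (∀ {t} → R′ ℕ.≤ t → ¬ Expansion t)
      expanded : Visit p j m → ∀ {S} → at p m ≡ S → IsNode S →
                 acting j m S ≡ false → expanding j m S ≡ true → Result
      expanded v eq (node {w} {a} {l} {c} {k} {q} {A} {B}) act exp =
        suc m , ℕ.m≤n⇒m≤1+n R≤m , trans (trans (sub-++ p (finite ∷ []) (tree (suc m)))
          (cong (sub (finite ∷ [])) (trans (At-next v) (cong (next j m) eq)))) (cleared c) , no-exp
        where
        cleared : ∀ c → sub (finite ∷ []) (next j m (node w a l c k q A B)) ≡ leaf
        cleared zero rewrite act | exp with step (suc j) m A
        ... | _ , nothing = refl
        ... | _ , just _  = refl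
        cleared (suc c) rewrite act | exp = refl
      decide : Visit p j m ⊎ Skip p m → Result
      decide (inj₁ v) with expanding j m (at p m) in exp
      ... | true  = expanded v refl (is-node R≤m) (no-acts R≤m v) exp
      ... | false = last-expansion m (extend λ (_ , exp′) → contradiction (trans (sym exp) exp′) λ ())
      decide (inj₂ o) = last-expansion m (extend λ (v , _) → At-Off-disjoint v o)
        where
        At-Off-disjoint : ∀ {p e S e′ S′} → At m p e S e′ S′ → Off m p e S → ⊥
        At-Off-disjoint (inf x y u) (wait x′ y′) = contradiction (trans (sym y) y′) λ ()
        At-Off-disjoint (inf x y u) (inf x′ y′ o) = At-Off-disjoint u o
        At-Off-disjoint (fin x y u) (fin x′ y′ o) = At-Off-disjoint u o

  module _ (em : ExcludedMiddle 0ℓ) where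

    -- The request flag is never withdrawn while the node survives, so it requests at most once;
    -- excluded middle decides whether it does.
    settle : ∀ {p j R} → Live p j R → ∃ λ R′ → R ℕ.< R′ × Settled p j R′
    settle {p} {j} {R} live with em {∃ λ t → suc r ℕ.≤ t × Visit p j t × acting j t (at p t) ≡ true}
      where open FirstVisit (first-visit live)
    ... | no never = suc r , s≤s R≤r , record
      { start   = _ , _ , _ , created
      ; stable  = λ le → Live.stable live (ℕ.≤-trans (ℕ.m≤n⇒m≤1+n R≤r) le)
      ; often   = Live.often live
      ; no-acts = no-acts }
      where
      open FirstVisit (first-visit live)
      no-acts : ∀ {t} → suc r ℕ.≤ t → Visit p j t → acting j t (at p t) ≡ false
      no-acts {t} le v with acting j t (at p t) in act
      ... | true  = contradiction (t , le , v , act) never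
      ... | false = refl
    ... | yes (s , r<s , v , act) = suc s , s≤s R≤s , record
      { start   = let w , l , eq = start (at p s) refl act in w , true , l , eq
      ; stable  = λ le → Live.stable live (ℕ.≤-trans (ℕ.m≤n⇒m≤1+n R≤s) le)
      ; often   = Live.often live
      ; no-acts = λ le _ → quiet (still-requested le) }
      where
      open FirstVisit (first-visit live)
      R≤s : R ℕ.≤ s
      R≤s = ℕ.≤-trans R≤r (ℕ.<⇒≤ r<s)
      start : ∀ S → at p s ≡ S → acting j s S ≡ true →
              ∃ λ w → ∃ λ l → at p (suc s) ≡ node w true l 0 0 0 leaf leaf
      start (node w a l c k q A B) eq act = w , l , trans (At-next v) (trans (cong (next j s) eq) acted)
        where
        acted : next j s (node w a l c k q A B) ≡ node w true l 0 0 0 leaf leaf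
        acted rewrite act = refl
      still-requested : ∀ {t} → suc s ℕ.≤ t → Requested (at p t)
      still-requested = from-induction (λ t → Requested (at p t)) base ih
        where
        base : Requested (at p (suc s))
        base with _ , _ , eq ← start (at p s) refl act rewrite eq = requested
        ih : ∀ {t} → suc s ℕ.≤ t → Requested (at p t) → Requested (at p (suc t))
        ih {t} s<t req with Live.stable live (ℕ.≤-trans (ℕ.m≤n⇒m≤1+n R≤s) s<t)
        ... | inj₁ u rewrite At-next u = next-requested j t req
        ... | inj₂ o rewrite Off-next o = req
      quiet : ∀ {t S} → Requested S → acting j t S ≡ false
      quiet requested = refl

    -- Settling moves R strictly forward at every level; the resulting j ≤ R makes the regaining
    -- stages unbounded.
    live-path : ∀ j → ∃ λ p → ∃ λ R → j ℕ.≤ R × Live p j R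
    live-path zero = [] , 0 , z≤n , record
      { fresh = refl ; stable = λ _ → inj₁ here ; often = λ m → m , ℕ.≤-refl , here }
    live-path (suc j) with p , R₀ , j≤R₀ , live ← live-path j with R , R₀<R , settled ← settle live
      with infinitely-often em (Expansion settled)
    ... | inj₁ often = p ++ infinite ∷ [] , R , ℕ.≤-trans (s≤s j≤R₀) R₀<R , live-infinite settled often
    ... | inj₂ (m , none) with R′ , R≤R′ , fresh , no-exp ← last-expansion settled m none =
      p ++ finite ∷ [] , R′ , ℕ.≤-trans (ℕ.≤-trans (s≤s j≤R₀) R₀<R) R≤R′ , live-finite settled R≤R′ fresh no-exp

-- Accounts along the true path

calm : ∀ x {o p p′ h H} → o + p′ ≤ p + h → h + h ≡ H → x + o + p′ + h ≤ x + p + H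
calm x {o} {p} {p′} {h} le refl = linear le (rearrange₁₈ x o p p′ h)

≤-+ʳ : ∀ x {y} → 0ℚ ≤ y → x ≤ x + y
≤-+ʳ x 0≤y = subst (_≤ x + _) (+-identityʳ x) (+-monoʳ-≤ x 0≤y)

mono⇒mono-≤ : ∀ {s} → Monotonic₁ ℕ._<_ ℕ._<_ s → Monotonic₁ ℕ._≤_ ℕ._≤_ s
mono⇒mono-≤ s-mono i≤k with ℕ.m≤n⇒m<n∨m≡n i≤k
... | inj₁ i<k  = ℕ.<⇒≤ (s-mono i<k)
... | inj₂ refl = ℕ.≤-refl

mono⇒inflationary : ∀ {s} → Monotonic₁ ℕ._<_ ℕ._<_ s → ∀ n → n ℕ.≤ s n
mono⇒inflationary s-mono zero    = z≤n
mono⇒inflationary s-mono (suc n) = ℕ.≤-trans (s≤s (mono⇒inflationary s-mono n)) (s-mono (ℕ.n<1+n n))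

-- Once a node makes no more requests, only its finite subtree can release anything before the next
-- expansion.
outside : Tree → ℚ
outside leaf                   = 0ℚ
outside (node w a l c k q A B) = μ B

outside-nonneg : ∀ S → 0ℚ ≤ outside S
outside-nonneg leaf                   = ≤-refl
outside-nonneg (node w a l c k q A B) = μ-nonneg B

expansionOf stageOf : Tree → ℕ
expansionOf leaf = 0
expansionOf (node w a l c k q A B) = l
stageOf leaf = 0
stageOf (node w a l c k q A B) = q

data Fresh (w : ℕ) : Tree → Set where
  fresh : ∀ {l c k q A B} → Fresh w (node w false l c k q A B)

module Analysis (conv : ℕ → ℕ → ℕ → Bool) where
  open Construction conv
  open Dynamics conv

  open Potential (λ _ → 0ℚ) (λ _ → 0ℚ) renaming (pot to owed; At-pot to At-owed)

  -- Side subtrees may be discarded, so they have weight zero here and only the pieces at infinite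
  -- guesses are owed. A piece that leaves its queue is either output or queued again nearer the
  -- root.
  Off-owed : ∀ {t p e S} → Off t p e S → owed p S ≤ out e t S + owed p (next e t S)
  Off-owed {t} (wait {p} {e} {c = c} {k} {q} {A} {B} x y) rewrite x | y with step (suc e) t B
  ... | _ , o = linear (amount-nonneg o) (rearrange₁₄ (amount o) (c · (½^ (k ℕ.+ q)) + owed p A + 0ℚ))
  Off-owed (emit {p} {c = c} {k} {q} {A} x y) rewrite x | y =
    ≤-reflexive (rearrange₁₅ (½^ (k ℕ.+ q)) (c · (½^ (k ℕ.+ q))) (owed p A))
  Off-owed {t} (inf {p} {e} {A = A} x y u) rewrite x | y with step (suc e) t A | Off-owed u
  ... | A′ , nothing | ih = linear ih (rearrange₁₆ (owed p A) (owed p A′))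
  ... | A′ , just k  | ih rewrite 2^n·½^n k t = linear ih (rearrange₁₇ (½^ k) (owed p A) (owed p A′))
  Off-owed (fin x y u) rewrite x | y = Off-owed u

  At-owed-zero : ∀ {t p e S e′ S′} → At t p e S e′ S′ → owed p S ≡ 0ℚ
  At-owed-zero here = refl
  At-owed-zero (inf x y u) rewrite At-owed-zero u = refl
  At-owed-zero (fin x y u) = At-owed-zero u

  -- After the first visit only nodes created later contribute.
  regain : ∀ {p j R} (live : Live p j R) → let open FirstVisit (first-visit live) in
           ∀ u → x u ≤ x r + ½^ suc r
  regain {p} {j} live u with ℕ.≤-total u r
    where open FirstVisit (first-visit live)
  ... | inj₁ u≤r = ≤-trans (x-mono u≤r) (≤-+ʳ _ (½^-nonneg _))
  ... | inj₂ r≤u = ≤-trans (x-mono (ℕ.n≤1+n u)) (≤-trans (≤-+ʳ _ (pot-nonneg μ-nonneg p (tree (suc u))))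
                     (≤-trans (≤-+ʳ _ (½^-nonneg (2 ℕ.+ u))) (bound (s≤s r≤u))))
    where
    open FirstVisit (first-visit live)
    open Upper μ
    -- The summand ½^(u + 1) is the reserve for all nodes created from stage u on; `calm` pays each
    -- new node out of it.
    Bound : ℕ → Set
    Bound u = x u + pot p (tree u) + ½^ suc u ≤ x r + ½^ suc r
    -- The visit empties everything outside the new node. Its own request and the remaining reserve
    -- are ½^(r + 2) each.
    base : Bound (suc r)
    base = ≤-reflexive (trans (cong (_+ ½^ (2 ℕ.+ r)) (trans (+-assoc (x r) _ _) (cong (x r +_)
             (trans (At-pot refl visited) start))))
             (trans (rearrange₁₉ (x r) (½^ (2 ℕ.+ r))) (cong (x r +_) (½^-double (suc r)))))
      where
      start : out j r (at p r) + μ (next j r (at p r)) ≡ ½^ (2 ℕ.+ r) + 0ℚ + (0ℚ + 0ℚ)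
      start rewrite empty = +-identityˡ _
    bound : ∀ {u} → suc r ℕ.≤ u → Bound u
    bound = from-induction Bound base ih
      where
      ih : ∀ {u} → suc r ℕ.≤ u → Bound u → Bound (suc u)
      ih {u} r<u le with Live.stable live (ℕ.≤-trans (ℕ.m≤n⇒m≤1+n R≤r) r<u)
      ... | inj₂ o = ≤-trans (calm (x u) (Off-pot o) (½^-double (suc u))) le
      ... | inj₁ v = ≤-trans (calm (x u) (≤-trans (≤-reflexive (At-pot refl v))
                       (≤-trans (μ-step j u (at p u)) (+-monoˡ-≤ (½^ (2 ℕ.+ u)) (At-pot-≥ v))))
                     (½^-double (suc u))) le

  next-fresh : ∀ j t {w S} → Fresh w S → acting j t S ≡ false → Fresh w (next j t S)
  next-fresh j t (fresh {l} {c} {k} {q} {A} {B}) act rewrite act with expands j t l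
  ... | false = fresh
  next-fresh j t (fresh {c = suc _}) act | true = fresh
  next-fresh j t (fresh {c = zero} {A = A}) act | true with step (suc j) t A
  ... | _ , nothing = fresh
  ... | _ , just _  = fresh

  out-acting : ∀ j t {w S} → Fresh w S → acting j t S ≡ true → out j t S ≡ ½^ (2 ℕ.+ w)
  out-acting j t fresh act rewrite act = refl

  -- By the next visit, a request made at stage t has been passed on completely.
  gap : ∀ {p j R f} → Live p j R → Decides (conv j) f → ∃ λ k → ∃ λ t → ∃ λ u → f k ℕ.≤ t × x t + ½^ k ≤ x u
  gap {p} {j} {f = f} live decides = conclude (acts-eventually)
    where
    open FirstVisit (first-visit live)
    open Decides decides
    stable : ∀ {t} → suc r ℕ.≤ t → Visit p j t ⊎ Skip p t
    stable r<t = Live.stable live (ℕ.≤-trans (ℕ.m≤n⇒m≤1+n R≤r) r<t)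
    Acts : Set
    Acts = ∃ λ t → suc r ℕ.≤ t × Visit p j t × Fresh r (at p t) × acting j t (at p t) ≡ true
    unless-acted : ∀ {t} → suc r ℕ.≤ t → Acts ⊎ Fresh r (at p t)
    unless-acted = from-induction (λ t → Acts ⊎ Fresh r (at p t)) (inj₂ (subst (Fresh r) (sym created) fresh)) ih
      where
      ih : ∀ {t} → suc r ℕ.≤ t → Acts ⊎ Fresh r (at p t) → Acts ⊎ Fresh r (at p (suc t))
      ih r<t (inj₁ acted) = inj₁ acted
      ih {t} r<t (inj₂ fr) with stable r<t
      ... | inj₂ o rewrite Off-next o = inj₂ fr
      ... | inj₁ v with acting j t (at p t) in act
      ... | true  = inj₁ (t , r<t , v , fr , act)
      ... | false rewrite At-next v = inj₂ (next-fresh j t fr act)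
    acts-eventually : Acts
    acts-eventually with t₀ , conv-from ← halts (2 ℕ.+ r)
                    with t , le , v ← Live.often live (t₀ ℕ.⊔ suc r)
                    with unless-acted (ℕ.≤-trans (ℕ.m≤n⊔m t₀ (suc r)) le)
    ... | inj₁ acted = acted
    ... | inj₂ fr = t , ℕ.≤-trans (ℕ.m≤n⊔m t₀ (suc r)) le , v , fr , act fr
      where
      act : ∀ {S} → Fresh r S → acting j t S ≡ true
      act fresh = conv-from (ℕ.≤-trans (ℕ.m≤m⊔n t₀ (suc r)) le)
    conclude : Acts → ∃ λ k → ∃ λ t → ∃ λ u → f k ℕ.≤ t × x t + ½^ k ≤ x u
    conclude (t , r<t , v , fr , act) with u , t<u , v′ ← Live.often live (suc t) =
      -- The argument whose convergence triggers the request is also the exponent of the request.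
      2 ℕ.+ r , t , proj₁ paid , bounds (converged fr act) , proj₂ paid
      where
      converged : ∀ {S} → Fresh r S → acting j t S ≡ true → conv j (2 ℕ.+ r) t ≡ true
      converged fresh act = act
      goal : ℚ
      goal = x t + ½^ (2 ℕ.+ r)
      Paid : Set
      Paid = ∃ λ u → goal ≤ x u
      visited-paid : ∀ {u} → Visit p j u → goal ≤ x u + owed p (tree u) → Paid
      visited-paid {u} v le =
        u , ≤-trans le (≤-reflexive (trans (cong (x u +_) (At-owed-zero v)) (+-identityʳ (x u))))
      owing : ∀ {u} → suc t ℕ.≤ u → Paid ⊎ (goal ≤ x u + owed p (tree u))
      owing = from-induction (λ u → Paid ⊎ (goal ≤ x u + owed p (tree u))) (inj₂ base) ih
        where
        base : goal ≤ x (suc t) + owed p (tree (suc t))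
        base = ≤-reflexive (sym (trans (+-assoc (x t) _ _) (cong (x t +_)
          (trans (At-owed refl v) (trans (+-identityʳ _) (out-acting j t fr act))))))
        ih : ∀ {u} → suc t ℕ.≤ u → Paid ⊎ (goal ≤ x u + owed p (tree u)) →
             Paid ⊎ (goal ≤ x (suc u) + owed p (tree (suc u)))
        ih t<u (inj₁ paid) = inj₁ paid
        ih {u} t<u (inj₂ le) with stable (ℕ.≤-trans (ℕ.m≤n⇒m≤1+n r<t) t<u)
        ... | inj₁ v = inj₁ (visited-paid v le)
        ... | inj₂ o = inj₂ (≤-trans le (≤-trans (+-monoʳ-≤ (x u) (Off-owed o))
                         (≤-reflexive (sym (+-assoc (x u) _ _)))))
      paid : Paid
      paid with owing t<u
      ... | inj₁ paid = paid
      ... | inj₂ le   = visited-paid v′ le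

  module _ {p : Path} {j R : ℕ} (settled : Settled p j R) where
    open Upper outside

    -- Without an expansion, value, potential and reserve together do not grow. An expansion instead
    -- clears the potential: a pull releases nothing, and a piece ½^(k + q) is at most ½^q whatever
    -- k is.
    data Account (t : ℕ) : Set where
      calmly : expansionOf (at p (suc t)) ≡ expansionOf (at p t) → stageOf (at p (suc t)) ≡ stageOf (at p t) →
               x (suc t) + pot p (tree (suc t)) + ½^ (2 ℕ.+ t) ≤ x t + pot p (tree t) + ½^ suc t → Account t
      burst  : conv j (suc (expansionOf (at p t))) t ≡ true → expansionOf (at p (suc t)) ≡ t →
               stageOf (at p (suc t)) ≡ stageOf (at p t) ⊎ stageOf (at p (suc t)) ≡ t →
               x (suc t) + pot p (tree (suc t)) ≤ x t + ½^ (stageOf (at p (suc t))) → Account t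

    account : ∀ {t} → R ℕ.≤ t → Account t
    account {t} R≤t = of-evolution refl refl (evolve settled R≤t)
      where
      visited : Visit p j t → ∀ {S} → at p t ≡ S →
                x (suc t) + pot p (tree (suc t)) ≡ x t + (out j t S + outside (next j t S))
      visited v refl = trans (+-assoc (x t) _ _) (cong (x t +_) (At-pot refl v))

      of-evolution : ∀ {S S′} → at p t ≡ S → at p (suc t) ≡ S′ → Evolution p j t S S′ → Account t
      of-evolution eq eq′ (skip o) =
        calmly (cong expansionOf (trans eq′ (sym eq))) (cong stageOf (trans eq′ (sym eq)))
               (calm (x t) (Off-pot o) (½^-double (suc t)))
      of-evolution eq eq′ (pass {w} {a} {l} {c} {k} {q} {A} {B} v act exp) =
        calmly (trans (cong expansionOf eq′) (sym (cong expansionOf eq)))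
               (trans (cong stageOf eq′) (sym (cong stageOf eq)))
               (calm (x t) (≤-trans (≤-reflexive (At-pot refl v))
                 (subst (λ S → out j t S + outside (next j t S) ≤ pot p (tree t) + ½^ (2 ℕ.+ t)) (sym eq) bound))
                 (½^-double (suc t)))
        where
        passed : out j t (node w a l c k q A B) + outside (next j t (node w a l c k q A B)) ≡
                 out (suc j) t B + μ (next (suc j) t B)
        passed rewrite act | exp = refl
        bound : out j t (node w a l c k q A B) + outside (next j t (node w a l c k q A B)) ≤
                pot p (tree t) + ½^ (2 ℕ.+ t)
        bound = ≤-trans (≤-reflexive passed) (≤-trans (μ-step (suc j) t B)
          (+-monoˡ-≤ (½^ (2 ℕ.+ t)) (subst (λ S → outside S ≤ pot p (tree t)) eq (At-pot-≥ v))))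
      of-evolution eq eq′ (piece {w} {a} {l} {c} {k} {q} {A} {B} v act exp) =
        burst (trans (cong (λ S → conv j (suc (expansionOf S)) t) eq) exp) (cong expansionOf eq′)
              (inj₁ (trans (cong stageOf eq′) (sym (cong stageOf eq))))
              (≤-trans (≤-reflexive (visited v eq)) (+-monoʳ-≤ (x t) (≤-trans (≤-reflexive emitted)
                (≤-trans (½^-antitone (ℕ.m≤n+m q k)) (≤-reflexive (cong (λ S → ½^ (stageOf S)) (sym eq′)))))))
        where
        emitted : out j t (node w a l (suc c) k q A B) +
                  outside (next j t (node w a l (suc c) k q A B)) ≡ ½^ (k ℕ.+ q)
        emitted rewrite act | exp = +-identityʳ (½^ (k ℕ.+ q))
      of-evolution eq eq′ (pull {w} {a} {l} {c} {k} {q} {A} {B} v act exp refl) =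
        burst (trans (cong (λ S → conv j (suc (expansionOf S)) t) eq) exp) (cong expansionOf eq′)
              (inj₂ (cong stageOf eq′))
              (≤-trans (≤-reflexive (visited v eq)) (+-monoʳ-≤ (x t) (≤-trans (≤-reflexive silent) (½^-nonneg _))))
        where
        silent : out j t (node w a l 0 k q A B) + outside (next j t (node w a l 0 k q A B)) ≡ 0ℚ
        silent rewrite act | exp with step (suc j) t A
        ... | _ , nothing = refl
        ... | _ , just _  = refl

    stage≤ : ∀ {t} → R ℕ.≤ t → stageOf (at p t) ℕ.≤ t
    stage≤ = from-induction (λ t → stageOf (at p t) ℕ.≤ t) base ih
      where
      base : stageOf (at p R) ℕ.≤ R
      base with _ , _ , _ , eq ← Settled.start settled rewrite eq = z≤n
      ih : ∀ {t} → R ℕ.≤ t → stageOf (at p t) ℕ.≤ t → stageOf (at p (suc t)) ℕ.≤ suc t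
      ih R≤t le with account R≤t
      ... | calmly _ eq _          = subst (ℕ._≤ _) (sym eq) (ℕ.m≤n⇒m≤1+n le)
      ... | burst _ _ (inj₁ eq) _  = subst (ℕ._≤ _) (sym eq) (ℕ.m≤n⇒m≤1+n le)
      ... | burst _ _ (inj₂ eq) _  = subst (ℕ._≤ _) (sym eq) (ℕ.n≤1+n _)

    burst-stage≤ : ∀ {t} → R ℕ.≤ t →
      stageOf (at p (suc t)) ≡ stageOf (at p t) ⊎ stageOf (at p (suc t)) ≡ t → stageOf (at p (suc t)) ℕ.≤ t
    burst-stage≤ R≤t (inj₁ eq) = subst (ℕ._≤ _) (sym eq) (stage≤ R≤t)
    burst-stage≤ R≤t (inj₂ eq) = ℕ.≤-reflexive eq

    -- The recorded stage is only ever overwritten by the current one, so pieces that have become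
    -- small stay small. This turns a single stage found by search into a modulus.
    stage-grows : ∀ {t} → R ℕ.≤ t → stageOf (at p t) ℕ.≤ stageOf (at p (suc t))
    stage-grows R≤t with account R≤t
    ... | calmly _ eq _         = ℕ.≤-reflexive (sym eq)
    ... | burst _ _ (inj₁ eq) _ = ℕ.≤-reflexive (sym eq)
    ... | burst _ _ (inj₂ eq) _ = ℕ.≤-trans (stage≤ R≤t) (ℕ.≤-reflexive (sym eq))

    -- One half of ½^m covers the piece released, the other half the reserve for nodes created
    -- later.
    burst-bound : ∀ {t} m → R ℕ.≤ t → suc m ℕ.≤ stageOf (at p (suc t)) →
      stageOf (at p (suc t)) ≡ stageOf (at p t) ⊎ stageOf (at p (suc t)) ≡ t →
      x (suc t) + pot p (tree (suc t)) ≤ x t + ½^ (stageOf (at p (suc t))) →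
      x (suc t) + pot p (tree (suc t)) + ½^ (2 ℕ.+ t) ≤ x t + ½^ m
    burst-bound {t} m R≤t m<stage stage≡ le = ≤-trans
      (+-mono-≤ (≤-trans le (+-monoʳ-≤ (x t) (½^-antitone m<stage)))
                (½^-antitone {suc m} (ℕ.≤-trans m<stage (ℕ.≤-trans (burst-stage≤ R≤t stage≡) (ℕ.m≤n+m t 2)))))
      (≤-reflexive (trans (+-assoc (x t) _ _) (cong (x t +_) (½^-double m))))

    -- An upper bound for what x can still gain before the next expansion of the node.
    excess : ℕ → ℚ
    excess t = pot p (tree t) + ½^ suc t

    -- The recorded stage is 0 at the settled start, so a positive one shows that an expansion has
    -- happened since; that expansion cut the excess down, and calm stages do not raise it.
    excess-bound : ∀ {t} m → R ℕ.≤ t → suc m ℕ.≤ stageOf (at p t) → excess t ≤ ½^ m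
    excess-bound m = from-induction (λ t → suc m ℕ.≤ stageOf (at p t) → excess t ≤ ½^ m) base ih
      where
      cancel : ∀ {t} {h} → x (suc t) + pot p (tree (suc t)) + ½^ (2 ℕ.+ t) ≤ x t + h → excess (suc t) ≤ h
      cancel {t} {h} le = linear (+-mono-≤ le (x-mono-suc t)) (rearrange₂₀ (x t) (x (suc t)) _ _ h)
      base : suc m ℕ.≤ stageOf (at p R) → excess R ≤ ½^ m
      base m<stage with _ , _ , _ , eq ← Settled.start settled rewrite eq = contradiction m<stage λ ()
      ih : ∀ {t} → R ℕ.≤ t → (suc m ℕ.≤ stageOf (at p t) → excess t ≤ ½^ m) →
           suc m ℕ.≤ stageOf (at p (suc t)) → excess (suc t) ≤ ½^ m
      ih {t} R≤t le m<stage with account R≤t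
      ... | calmly _ eq le′ =
        ≤-trans (cancel (≤-trans le′ (≤-reflexive (+-assoc (x t) _ _)))) (le (subst (suc m ℕ.≤_) eq m<stage))
      ... | burst _ _ stage≡ le′ = cancel (burst-bound m R≤t m<stage stage≡ le′)

    -- Between two values of s there is at most one expansion.
    window : ∀ {s m n} → Decides (conv j) s → Monotonic₁ ℕ._<_ ℕ._<_ s →
             R ℕ.≤ s n → suc (suc m) ℕ.≤ stageOf (at p (s n)) → x (s (suc n)) ≤ x (s n) + ½^ m
    window {s} {m} {n} decides s-mono R≤a m<stage = conclude (proj₂ (inside (ℕ.<⇒≤ (s-mono (ℕ.n<1+n n))) ℕ.≤-refl))
      where
      open Decides decides
      -- Before the expansion of the window the budget is the initial excess ½^(m + 1); the
      -- expansion adds at most as much again.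
      Phase : ℕ → Set
      Phase u = x u + excess u ≤ x (s n) + ½^ suc m ⊎
                (s n ℕ.≤ expansionOf (at p u) × x u + excess u ≤ x (s n) + ½^ m)
      Inside : ℕ → Set
      Inside u = u ℕ.≤ s (suc n) → suc (suc m) ℕ.≤ stageOf (at p u) × Phase u
      excess≥0 : ∀ u → 0ℚ ≤ excess u
      excess≥0 u = +-mono-≤ (pot-nonneg outside-nonneg p (tree u)) (½^-nonneg (suc u))
      inside : ∀ {u} → s n ℕ.≤ u → Inside u
      inside = from-induction Inside
        (λ _ → m<stage , inj₁ (+-monoʳ-≤ (x (s n)) (excess-bound (suc m) R≤a m<stage))) ih
        where
        ih : ∀ {u} → s n ℕ.≤ u → Inside u → Inside (suc u)
        ih {u} a≤u ins u<b with ins (ℕ.<⇒≤ u<b) | ℕ.≤-trans R≤a a≤u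
        ... | m<q , phase | R≤u with ℕ.≤-trans m<q (stage-grows R≤u) | account R≤u | phase
        ... | m<q′ | calmly _ _ le | inj₁ bound = m<q′ , inj₁ (≤-trans (regroup le) bound)
          where
          regroup : x (suc u) + pot p (tree (suc u)) + ½^ (2 ℕ.+ u) ≤ x u + pot p (tree u) + ½^ suc u →
                    x (suc u) + excess (suc u) ≤ x u + excess u
          regroup = subst₂ _≤_ (+-assoc (x (suc u)) _ _) (+-assoc (x u) _ _)
        ... | m<q′ | calmly l≡ _ le | inj₂ (late , bound) =
          m<q′ , inj₂ (subst (s n ℕ.≤_) (sym l≡) late ,
            ≤-trans (subst₂ _≤_ (+-assoc (x (suc u)) _ _) (+-assoc (x u) _ _) le) bound)
        ... | m<q′ | burst _ l≡ stage≡ le | inj₁ bound = m<q′ , inj₂ (subst (s n ℕ.≤_) (sym l≡) a≤u , (begin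
          x (suc u) + excess (suc u)                                        ≡⟨ +-assoc (x (suc u)) _ _ ⟨
          x (suc u) + pot p (tree (suc u)) + ½^ (2 ℕ.+ u)                   ≤⟨ burst-bound (suc m) R≤u m<q′ stage≡ le ⟩
          x u + ½^ suc m                                                    ≤⟨ +-monoˡ-≤ (½^ suc m) x≤ ⟩
          x (s n) + ½^ suc m + ½^ suc m                                     ≡⟨ +-assoc (x (s n)) _ _ ⟩
          x (s n) + (½^ suc m + ½^ suc m)                                   ≡⟨ cong (x (s n) +_) (½^-double m) ⟩
          x (s n) + ½^ m                                                    ∎))
          where
          open ℚ.≤-Reasoning
          x≤ : x u ≤ x (s n) + ½^ suc m
          x≤ = ≤-trans (≤-+ʳ (x u) (excess≥0 u)) bound
        -- With l the earlier expansion, n ≤ s n ≤ l gives s (n + 1) ≤ s (l + 1) ≤ u, so u lies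
        -- beyond the window.
        ... | m<q′ | burst expanded _ _ _ | inj₂ (late , _) = contradiction (ℕ.≤-trans u<b
          (ℕ.≤-trans (mono⇒mono-≤ s-mono (s≤s (ℕ.≤-trans (mono⇒inflationary s-mono n) late))) (bounds expanded)))
          (ℕ.<-irrefl refl)
      conclude : Phase (s (suc n)) → x (s (suc n)) ≤ x (s n) + ½^ m
      conclude (inj₁ le)       = ≤-trans (≤-+ʳ _ (excess≥0 _))
        (≤-trans le (+-monoʳ-≤ (x (s n)) (½^-antitone (ℕ.n≤1+n m))))
      conclude (inj₂ (_ , le)) = ≤-trans (≤-+ʳ _ (excess≥0 _)) le

    -- If expansions ceased, l would be frozen; the program converges at l + 1, and the first visit
    -- after that would be an expansion.
    expands-often : ∀ {f} → ExcludedMiddle 0ℓ → Decides (conv j) f → ∀ m → ∃ λ t → m ℕ.≤ t × Expansion settled t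
    expands-often em decides with infinitely-often em (Expansion settled)
    ... | inj₁ often      = often
    ... | inj₂ (m , none) = contradiction (v , expanding-now (is-node settled R≤t) constant-now) (none m≤t)
      where
      M : ℕ
      M = R ℕ.⊔ m
      l : ℕ
      l = expansionOf (at p M)
      constant : ∀ {t} → M ℕ.≤ t → expansionOf (at p t) ≡ l
      constant = from-induction (λ t → expansionOf (at p t) ≡ l) refl ih
        where
        ih : ∀ {t} → M ℕ.≤ t → expansionOf (at p t) ≡ l → expansionOf (at p (suc t)) ≡ l
        ih {t} M≤t eq = of-evolution refl refl (evolve settled (ℕ.≤-trans (ℕ.m≤m⊔n R m) M≤t))
          where
          ¬expansion : ¬ Expansion settled t
          ¬expansion = none (ℕ.≤-trans (ℕ.m≤n⊔m R m) M≤t)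
          of-evolution : ∀ {S S′} → at p t ≡ S → at p (suc t) ≡ S′ → Evolution p j t S S′ →
                         expansionOf (at p (suc t)) ≡ l
          of-evolution e e′ (skip _)          = trans (cong expansionOf (trans e′ (sym e))) eq
          of-evolution e e′ (pass _ _ _)      = trans (trans (cong expansionOf e′) (sym (cong expansionOf e))) eq
          of-evolution e e′ (piece v _ exp)   = contradiction (v , trans (cong (expanding j t) e) exp) ¬expansion
          of-evolution e e′ (pull v _ exp _)  = contradiction (v , trans (cong (expanding j t) e) exp) ¬expansion
      halting : ∃ λ t₀ → ∀ {t} → t₀ ℕ.≤ t → conv j (suc l) t ≡ true
      halting = Decides.halts decides (suc l)
      next-visit : ∃ λ t → proj₁ halting ℕ.⊔ M ℕ.≤ t × Visit p j t
      next-visit = Settled.often settled (proj₁ halting ℕ.⊔ M)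
      t : ℕ
      t = proj₁ next-visit
      v : Visit p j t
      v = proj₂ (proj₂ next-visit)
      ⊔≤t : proj₁ halting ℕ.⊔ M ℕ.≤ t
      ⊔≤t = proj₁ (proj₂ next-visit)
      M≤t : M ℕ.≤ t
      M≤t = ℕ.≤-trans (ℕ.m≤n⊔m (proj₁ halting) M) ⊔≤t
      m≤t : m ℕ.≤ t
      m≤t = ℕ.≤-trans (ℕ.m≤n⊔m R m) M≤t
      R≤t : R ℕ.≤ t
      R≤t = ℕ.≤-trans (ℕ.m≤m⊔n R m) M≤t
      constant-now : expansionOf (at p t) ≡ l
      constant-now = constant M≤t
      expanding-now : ∀ {S} → IsNode S → expansionOf S ≡ l → expanding j t S ≡ true
      expanding-now node refl = proj₂ halting (ℕ.≤-trans (ℕ.m≤m⊔n (proj₁ halting) M) ⊔≤t)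

    stage-unbounded : ∀ {f} → ExcludedMiddle 0ℓ → Decides (conv j) f → ∀ m → ∃ λ t → m ℕ.≤ t × m ℕ.≤ stageOf (at p t)
    stage-unbounded em decides m with t , le , (v , exp) , c≡0 ← pulls settled (expands-often em decides) (R ℕ.⊔ m) =
      suc t , ℕ.m≤n⇒m≤1+n m≤t ,
      subst (m ℕ.≤_) (sym (trans (cong stageOf (At-next v))
        (pulled (is-node settled R≤t) (Settled.no-acts settled R≤t v) exp c≡0))) m≤t
      where
      m≤t : m ℕ.≤ t
      m≤t = ℕ.≤-trans (ℕ.m≤n⊔m R m) le
      R≤t : R ℕ.≤ t
      R≤t = ℕ.≤-trans (ℕ.m≤m⊔n R m) le
      pulled : ∀ {S} → IsNode S → acting j t S ≡ false → expanding j t S ≡ true → pending S ≡ 0 →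
               stageOf (next j t S) ≡ t
      pulled (node {A = A}) act exp refl rewrite act | exp with step (suc j) t A
      ... | _ , nothing = refl
      ... | _ , just _  = refl

-- Computability of the construction

Fields : Set
Fields = ℕ × Bool × ℕ × ℕ × ℕ × ℕ × Tree × Tree

encodeTree : Tree → ℕ
encodeTree leaf = pair 0 0
encodeTree (node w a l c k q A B) =
  pair 1 (pair w (pair (encode a) (pair l (pair c (pair k (pair q (pair (encodeTree A) (encodeTree B))))))))

instance
  Tree-encoding : Encoding Tree
  Tree-encoding .encode = encodeTree

  Maybe-encoding : ∀ {A} {{_ : Encoding A}} → Encoding (Maybe A)
  Maybe-encoding .encode nothing  = pair 0 0
  Maybe-encoding .encode (just a) = pair 1 (encode a)

Tree-view : Tree → ⊤ ⊎ Fields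
Tree-view leaf = inj₁ tt
Tree-view (node w a l c k q A B) = inj₂ (w , a , l , c , k , q , A , B)

Tree-viewᶜ : Comp Tree-view
Tree-viewᶜ = recode λ { leaf → refl ; (node _ _ _ _ _ _ _ _) → refl }

nodeᶜ : Comp {Fields} λ (w , a , l , c , k , q , A , B) → node w a l c k q A B
nodeᶜ = recode {f = λ { (inj₁ tt) → leaf ; (inj₂ (w , a , l , c , k , q , A , B)) → node w a l c k q A B }}
          (λ { (inj₁ tt) → refl ; (inj₂ _) → refl }) ∘ᶜ inj₂ᶜ {⊤}

Maybe-view : ∀ {A : Set} → Maybe A → ⊤ ⊎ A
Maybe-view nothing  = inj₁ tt
Maybe-view (just a) = inj₂ a

Maybe-viewᶜ : ∀ {A} {{_ : Encoding A}} → Comp (Maybe-view {A})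
Maybe-viewᶜ = recode λ { nothing → refl ; (just _) → refl }

justᶜ : ∀ {A} {{_ : Encoding A}} → Comp (just {A = A})
justᶜ = recode {f = λ { (inj₁ tt) → nothing ; (inj₂ a) → just a }}
          (λ { (inj₁ tt) → refl ; (inj₂ _) → refl }) ∘ᶜ inj₂ᶜ {⊤}

notᶜ : Comp not
notᶜ = ext (ifᶜ idᶜ (constᶜ false) (constᶜ true)) λ { true → refl ; false → refl }

∧ᶜ : Comp {Bool × Bool} λ (a , b) → a ∧ b
∧ᶜ = ext (ifᶜ fstᶜ sndᶜ (constᶜ false)) λ { (true , _) → refl ; (false , _) → refl }

resolveᶜ : Comp {(ℕ × Fields) × (Bool × Bool) × Tree × Maybe ℕ}
  λ ((t , w , a , l , c , k , q , A , B) , (act , exp) , r) → resolve t w a l c k q A B act exp r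
resolveᶜ = ext
  (ifᶜ act (nodeᶜ ∘ᶜ (w ,ᶜ constᶜ true ,ᶜ l ,ᶜ constᶜ 0 ,ᶜ constᶜ 0 ,ᶜ constᶜ 0 ,ᶜ constᶜ leaf ,ᶜ constᶜ leaf) ,ᶜ
            justᶜ ∘ᶜ sucᶜ (sucᶜ w)) $
   ifᶜ exp
     (natCaseᶜ {g = λ (((t , w , a , _ , _ , k , q , A , _) , _) , c) → node w a t c k q A leaf , just (k ℕ.+ q)}
       c
       (caseᶜ {f = λ (((t , w , a , _) , _ , A′ , _) , _) → node w a t 0 0 t A′ leaf , nothing}
              {g = λ (((t , w , a , _) , _ , A′ , _) , k′) → node w a t (2 ℕ.^ t) k′ t A′ leaf , nothing}
          (Maybe-viewᶜ ∘ᶜ o)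
          (nodeᶜ ∘ᶜ (w ∘ᶜ fstᶜ ,ᶜ a ∘ᶜ fstᶜ ,ᶜ t ∘ᶜ fstᶜ ,ᶜ constᶜ 0 ,ᶜ constᶜ 0 ,ᶜ
                     t ∘ᶜ fstᶜ ,ᶜ S′ ∘ᶜ fstᶜ ,ᶜ constᶜ leaf) ,ᶜ
           constᶜ nothing)
          (nodeᶜ ∘ᶜ (w ∘ᶜ fstᶜ ,ᶜ a ∘ᶜ fstᶜ ,ᶜ t ∘ᶜ fstᶜ ,ᶜ (2^ᶜ (t ∘ᶜ fstᶜ)) ,ᶜ sndᶜ ,ᶜ
                     t ∘ᶜ fstᶜ ,ᶜ S′ ∘ᶜ fstᶜ ,ᶜ constᶜ leaf) ,ᶜ
           constᶜ nothing))
       (nodeᶜ ∘ᶜ (w ∘ᶜ fstᶜ ,ᶜ a ∘ᶜ fstᶜ ,ᶜ t ∘ᶜ fstᶜ ,ᶜ sndᶜ ,ᶜ k ∘ᶜ fstᶜ ,ᶜ q ∘ᶜ fstᶜ ,ᶜ A ∘ᶜ fstᶜ ,ᶜ constᶜ leaf) ,ᶜ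
        justᶜ ∘ᶜ ((k +ᶜ q) ∘ᶜ fstᶜ)))
     (nodeᶜ ∘ᶜ (w ,ᶜ a ,ᶜ l ,ᶜ c ,ᶜ k ,ᶜ q ,ᶜ A ,ᶜ S′) ,ᶜ o))
  λ { ((t , w , a , l , c , k , q , A , B) , (true , _) , _) → refl
    ; ((t , w , a , l , c , k , q , A , B) , (false , false) , _) → refl
    ; ((t , w , a , l , suc c , k , q , A , B) , (false , true) , _) → refl
    ; ((t , w , a , l , zero , k , q , A , B) , (false , true) , _ , nothing) → refl
    ; ((t , w , a , l , zero , k , q , A , B) , (false , true) , _ , just _) → refl }
  where
  Γ : Set
  Γ = (ℕ × Fields) × (Bool × Bool) × Tree × Maybe ℕ
  t : Comp {Γ} λ ((t , _) , _) → t
  t = fstᶜ ∘ᶜ fstᶜ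
  w : Comp {Γ} λ ((_ , w , _) , _) → w
  w = fstᶜ ∘ᶜ sndᶜ ∘ᶜ fstᶜ
  a : Comp {Γ} λ ((_ , _ , a , _) , _) → a
  a = fstᶜ ∘ᶜ sndᶜ ∘ᶜ sndᶜ ∘ᶜ fstᶜ
  l : Comp {Γ} λ ((_ , _ , _ , l , _) , _) → l
  l = fstᶜ ∘ᶜ sndᶜ ∘ᶜ sndᶜ ∘ᶜ sndᶜ ∘ᶜ fstᶜ
  c : Comp {Γ} λ ((_ , _ , _ , _ , c , _) , _) → c
  c = fstᶜ ∘ᶜ sndᶜ ∘ᶜ sndᶜ ∘ᶜ sndᶜ ∘ᶜ sndᶜ ∘ᶜ fstᶜ
  k : Comp {Γ} λ ((_ , _ , _ , _ , _ , k , _) , _) → k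
  k = fstᶜ ∘ᶜ sndᶜ ∘ᶜ sndᶜ ∘ᶜ sndᶜ ∘ᶜ sndᶜ ∘ᶜ sndᶜ ∘ᶜ fstᶜ
  q : Comp {Γ} λ ((_ , _ , _ , _ , _ , _ , q , _) , _) → q
  q = fstᶜ ∘ᶜ sndᶜ ∘ᶜ sndᶜ ∘ᶜ sndᶜ ∘ᶜ sndᶜ ∘ᶜ sndᶜ ∘ᶜ sndᶜ ∘ᶜ fstᶜ
  A : Comp {Γ} λ ((_ , _ , _ , _ , _ , _ , _ , A , _) , _) → A
  A = fstᶜ ∘ᶜ sndᶜ ∘ᶜ sndᶜ ∘ᶜ sndᶜ ∘ᶜ sndᶜ ∘ᶜ sndᶜ ∘ᶜ sndᶜ ∘ᶜ sndᶜ ∘ᶜ fstᶜ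
  act : Comp {Γ} λ (_ , (act , _) , _) → act
  act = fstᶜ ∘ᶜ fstᶜ ∘ᶜ sndᶜ
  exp : Comp {Γ} λ (_ , (_ , exp) , _) → exp
  exp = sndᶜ ∘ᶜ fstᶜ ∘ᶜ sndᶜ
  S′ : Comp {Γ} λ (_ , _ , S′ , _) → S′
  S′ = fstᶜ ∘ᶜ sndᶜ ∘ᶜ sndᶜ
  o : Comp {Γ} λ (_ , _ , _ , o) → o
  o = sndᶜ ∘ᶜ sndᶜ ∘ᶜ sndᶜ

data Height≤ : ℕ → Tree → Set where
  leaf : ∀ {n} → Height≤ n leaf
  node : ∀ {n w a l c k q A B} → Height≤ n A → Height≤ n B → Height≤ (suc n) (node w a l c k q A B)

Height≤-suc : ∀ {n S} → Height≤ n S → Height≤ (suc n) S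
Height≤-suc leaf       = leaf
Height≤-suc (node h i) = node (Height≤-suc h) (Height≤-suc i)

stageOfᶜ : Comp stageOf
stageOfᶜ = ext
  (caseᶜ {f = λ _ → 0} {g = λ (_ , _ , _ , _ , _ , _ , q , _) → q} Tree-viewᶜ (constᶜ 0)
    (fstᶜ ∘ᶜ sndᶜ ∘ᶜ sndᶜ ∘ᶜ sndᶜ ∘ᶜ sndᶜ ∘ᶜ sndᶜ ∘ᶜ sndᶜ))
  λ { leaf → refl ; (node _ _ _ _ _ _ _ _) → refl }

module Computation (conv : ℕ → ℕ → ℕ → Bool) (convᶜ : Comp {ℕ × ℕ × ℕ} λ (e , n , t) → conv e n t) where
  open Construction conv
  open Dynamics conv

  State : Set
  State = ℕ × ℕ × Tree

  create : State → Tree × Maybe ℕ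
  create (e , t , S) = node t false t 0 0 0 leaf leaf , nothing

  down : State → State
  down (e , t , leaf) = suc e , t , leaf
  down (e , t , node w a l c k q A B) = suc e , t , (if expands e t l then A else B)

  up : State × Tree × Maybe ℕ → Tree × Maybe ℕ
  up (s@(e , t , leaf) , r) = create s
  up ((e , t , node w a l c k q A B) , r) = resolve t w a l c k q A B (acts e t w a) (expands e t l) r

  -- The height bound ensures that a leaf is reached before the levels run out. Surplus levels below
  -- it are harmless, because at a leaf `up` ignores their result.
  descend-step : ∀ {n S} e t → Height≤ n S → descend create up down n (e , t , S) ≡ step e t S
  descend-step {zero}  e t leaf = refl
  descend-step {suc n} e t leaf = refl
  descend-step e t (node {n} {w} {a} {l} {c} {k} {q} {A} {B} h i) =
    cong (resolve t w a l c k q A B (acts e t w a) (expands e t l)) (child (expands e t l))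
    where
    child : ∀ b → descend create up down n (suc e , t , (if b then A else B)) ≡
                  (if b then step (suc e) t A else step (suc e) t B)
    child true  = descend-step (suc e) t h
    child false = descend-step (suc e) t i

  next-height : ∀ {n S} e t → Height≤ n S → Height≤ (suc n) (next e t S)
  next-height e t leaf = node leaf leaf
  next-height e t (node {w = w} {a} {l} {c} {k} {q} {A} {B} h i) with acts e t w a | expands e t l
  ... | true  | _     = node leaf leaf
  ... | false | false = node (Height≤-suc h) (next-height (suc e) t i)
  next-height e t (node {c = suc c} h i) | false | true = node (Height≤-suc h) leaf
  next-height e t (node {c = zero} {A = A} h i) | false | true with step (suc e) t A | next-height (suc e) t h
  ... | _ , nothing | h′ = node h′ leaf
  ... | _ , just _  | h′ = node h′ leaf

  tree-height : ∀ t → Height≤ t (tree t)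
  tree-height zero    = leaf
  tree-height (suc t) = next-height 0 t (tree-height t)

  createᶜ : Comp create
  createᶜ =
    nodeᶜ ∘ᶜ (t ,ᶜ constᶜ false ,ᶜ t ,ᶜ constᶜ 0 ,ᶜ constᶜ 0 ,ᶜ constᶜ 0 ,ᶜ constᶜ leaf ,ᶜ constᶜ leaf) ,ᶜ
    constᶜ nothing
    where
    t : Comp {State} λ (_ , t , _) → t
    t = fstᶜ ∘ᶜ sndᶜ

  expandsᶜ : ∀ {A} {{_ : Encoding A}} {e t l : A → ℕ} → Comp e → Comp t → Comp l →
             Comp λ a → expands (e a) (t a) (l a)
  expandsᶜ e t l = convᶜ ∘ᶜ (e ,ᶜ sucᶜ l ,ᶜ t)

  actsᶜ : ∀ {A} {{_ : Encoding A}} {e t w : A → ℕ} {a : A → Bool} → Comp e → Comp t → Comp w → Comp a →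
          Comp λ x → acts (e x) (t x) (w x) (a x)
  actsᶜ e t w a = ∧ᶜ ∘ᶜ (notᶜ ∘ᶜ a ,ᶜ convᶜ ∘ᶜ (e ,ᶜ sucᶜ (sucᶜ w) ,ᶜ t))

  downᶜ : Comp down
  downᶜ = ext
    (caseᶜ {f = λ ((e , t , _) , _) → suc e , t , leaf}
           {g = λ ((e , t , _) , (w , a , l , c , k , q , A , B)) → suc e , t , (if expands e t l then A else B)}
      (Tree-viewᶜ ∘ᶜ sndᶜ ∘ᶜ sndᶜ)
      (sucᶜ (fstᶜ ∘ᶜ fstᶜ) ,ᶜ fstᶜ ∘ᶜ sndᶜ ∘ᶜ fstᶜ ,ᶜ constᶜ leaf)
      (sucᶜ (fstᶜ ∘ᶜ fstᶜ) ,ᶜ fstᶜ ∘ᶜ sndᶜ ∘ᶜ fstᶜ ,ᶜ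
        ifᶜ (expandsᶜ (fstᶜ ∘ᶜ fstᶜ) (fstᶜ ∘ᶜ sndᶜ ∘ᶜ fstᶜ) (fstᶜ ∘ᶜ sndᶜ ∘ᶜ sndᶜ ∘ᶜ sndᶜ))
            (fstᶜ ∘ᶜ sndᶜ ∘ᶜ sndᶜ ∘ᶜ sndᶜ ∘ᶜ sndᶜ ∘ᶜ sndᶜ ∘ᶜ sndᶜ ∘ᶜ sndᶜ)
            (sndᶜ ∘ᶜ sndᶜ ∘ᶜ sndᶜ ∘ᶜ sndᶜ ∘ᶜ sndᶜ ∘ᶜ sndᶜ ∘ᶜ sndᶜ ∘ᶜ sndᶜ)))
    λ { (e , t , leaf) → refl ; (e , t , node _ _ _ _ _ _ _ _) → refl }

  upᶜ : Comp up
  upᶜ = ext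
    (caseᶜ {f = λ ((s , _) , _) → create s}
           {g = λ (((e , t , _) , r) , (w , a , l , c , k , q , A , B)) →
                resolve t w a l c k q A B (acts e t w a) (expands e t l) r}
      (Tree-viewᶜ ∘ᶜ sndᶜ ∘ᶜ sndᶜ ∘ᶜ fstᶜ)
      (createᶜ ∘ᶜ fstᶜ ∘ᶜ fstᶜ)
      (resolveᶜ ∘ᶜ ((t ,ᶜ sndᶜ) ,ᶜ
        (actsᶜ e t (fstᶜ ∘ᶜ sndᶜ) (fstᶜ ∘ᶜ sndᶜ ∘ᶜ sndᶜ) ,ᶜ expandsᶜ e t (fstᶜ ∘ᶜ sndᶜ ∘ᶜ sndᶜ ∘ᶜ sndᶜ)) ,ᶜ
        sndᶜ ∘ᶜ fstᶜ)))
    λ { ((e , t , leaf) , _) → refl ; ((e , t , node _ _ _ _ _ _ _ _) , _) → refl }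
    where
    Γ : Set
    Γ = (State × Tree × Maybe ℕ) × Fields
    e : Comp {Γ} λ (((e , _) , _) , _) → e
    e = fstᶜ ∘ᶜ fstᶜ ∘ᶜ fstᶜ
    t : Comp {Γ} λ (((_ , t , _) , _) , _) → t
    t = fstᶜ ∘ᶜ sndᶜ ∘ᶜ fstᶜ ∘ᶜ fstᶜ

  -- The pair (n , E) stands for n / 2^E.
  addDyadic : Maybe ℕ → ℕ × ℕ → ℕ × ℕ
  addDyadic nothing  (n , E) = n , E
  addDyadic (just k) (n , E) = n ℕ.* 2 ℕ.^ k ℕ.+ 2 ℕ.^ E , E ℕ.+ k

  advance : ℕ → Tree × ℕ × ℕ → Tree × ℕ × ℕ
  advance t (S , d) =
    proj₁ (descend create up down t (0 , t , S)) , addDyadic (proj₂ (descend create up down t (0 , t , S))) d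

  trajectory : ℕ → Tree × ℕ × ℕ
  trajectory = natRec (leaf , 0 , 0) advance

  trajectoryᶜ : Comp trajectory
  trajectoryᶜ = natRecᶜ {g = λ (_ , t , s) → advance t s} idᶜ (constᶜ (leaf , 0 , 0)) (advanceᶜ ∘ᶜ sndᶜ)
    where
    addDyadicᶜ : Comp {Maybe ℕ × ℕ × ℕ} λ (o , d) → addDyadic o d
    addDyadicᶜ = ext
      (caseᶜ {f = λ ((_ , d) , _) → d} {g = λ ((_ , n , E) , k) → n ℕ.* 2 ℕ.^ k ℕ.+ 2 ℕ.^ E , E ℕ.+ k}
        (Maybe-viewᶜ ∘ᶜ fstᶜ) (sndᶜ ∘ᶜ fstᶜ)
        ((fstᶜ ∘ᶜ sndᶜ ∘ᶜ fstᶜ) *ᶜ (2^ᶜ sndᶜ) +ᶜ (2^ᶜ (sndᶜ ∘ᶜ sndᶜ ∘ᶜ fstᶜ)) ,ᶜ (sndᶜ ∘ᶜ sndᶜ ∘ᶜ fstᶜ) +ᶜ sndᶜ))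
      λ { (nothing , _) → refl ; (just _ , _) → refl }
    descended : Comp {ℕ × Tree × ℕ × ℕ} λ (t , S , _) → descend create up down t (0 , t , S)
    descended = descendᶜ createᶜ upᶜ downᶜ ∘ᶜ (fstᶜ ,ᶜ constᶜ 0 ,ᶜ fstᶜ ,ᶜ fstᶜ ∘ᶜ sndᶜ)
    advanceᶜ : Comp {ℕ × Tree × ℕ × ℕ} λ (t , s) → advance t s
    advanceᶜ = fstᶜ ∘ᶜ descended ,ᶜ addDyadicᶜ ∘ᶜ (sndᶜ ∘ᶜ descended ,ᶜ sndᶜ ∘ᶜ sndᶜ)

  trajectory-tree : ∀ t → proj₁ (trajectory t) ≡ tree t
  trajectory-tree zero    = refl
  trajectory-tree (suc t) rewrite trajectory-tree t = cong proj₁ (descend-step 0 t (tree-height t))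

  numerator exponent : ℕ → ℕ
  numerator t = proj₁ (proj₂ (trajectory t))
  exponent  t = proj₂ (proj₂ (trajectory t))

  numeratorᶜ : Comp numerator
  numeratorᶜ = fstᶜ ∘ᶜ sndᶜ ∘ᶜ trajectoryᶜ

  exponentᶜ : Comp exponent
  exponentᶜ = sndᶜ ∘ᶜ sndᶜ ∘ᶜ trajectoryᶜ

  treeᶜ : Comp tree
  treeᶜ = ext (fstᶜ ∘ᶜ trajectoryᶜ) trajectory-tree

  subᶜ : ∀ p → Comp (sub p)
  subᶜ []             = idᶜ
  subᶜ (infinite ∷ p) = ext
    (caseᶜ {f = λ _ → leaf} {g = λ (_ , _ , _ , _ , _ , _ , _ , A , _) → sub p A} Tree-viewᶜ (constᶜ leaf)
      (subᶜ p ∘ᶜ fstᶜ ∘ᶜ sndᶜ ∘ᶜ sndᶜ ∘ᶜ sndᶜ ∘ᶜ sndᶜ ∘ᶜ sndᶜ ∘ᶜ sndᶜ ∘ᶜ sndᶜ))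
    λ { leaf → refl ; (node _ _ _ _ _ _ _ _) → refl }
  subᶜ (finite ∷ p) = ext
    (caseᶜ {f = λ _ → leaf} {g = λ (_ , _ , _ , _ , _ , _ , _ , _ , B) → sub p B} Tree-viewᶜ (constᶜ leaf)
      (subᶜ p ∘ᶜ sndᶜ ∘ᶜ sndᶜ ∘ᶜ sndᶜ ∘ᶜ sndᶜ ∘ᶜ sndᶜ ∘ᶜ sndᶜ ∘ᶜ sndᶜ ∘ᶜ sndᶜ))
    λ { leaf → refl ; (node _ _ _ _ _ _ _ _) → refl }

  dyadic : ℕ × ℕ → ℚ
  dyadic (n , E) = _/_ (ℤ.+ n) (2 ℕ.^ E) {{ℕ.m^n≢0 2 E}}

  addDyadic-amount : ∀ o d → dyadic (addDyadic o d) ≡ dyadic d + amount o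
  addDyadic-amount nothing  d       = sym (ℚ.+-identityʳ (dyadic d))
  addDyadic-amount (just k) (n , E) = begin
    dyadic (n ℕ.* 2 ℕ.^ k ℕ.+ 2 ℕ.^ E , E ℕ.+ k)
      ≡⟨ /-≡ (n ℕ.* 2 ℕ.^ k ℕ.+ 2 ℕ.^ E) (2 ℕ.^ (E ℕ.+ k)) (n ℕ.* 2 ℕ.^ k ℕ.+ 1 ℕ.* 2 ℕ.^ E) (2 ℕ.^ E ℕ.* 2 ℕ.^ k)
           (cong₂ ℕ._*_ (cong (n ℕ.* 2 ℕ.^ k ℕ.+_) (sym (ℕ.*-identityˡ (2 ℕ.^ E))))
             (sym (ℕ.^-distribˡ-+-* 2 E k))) ⟩
    (ℤ.+ (n ℕ.* 2 ℕ.^ k ℕ.+ 1 ℕ.* 2 ℕ.^ E)) / (2 ℕ.^ E ℕ.* 2 ℕ.^ k)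
      ≡⟨ /-add n (2 ℕ.^ E) 1 (2 ℕ.^ k) ⟨
    dyadic (n , E) + 2^- k
      ≡⟨ cong (dyadic (n , E) +_) (½^≡2^- k) ⟨
    dyadic (n , E) + ½^ k ∎
    where
    open ≡-Reasoning
    instance
      2^E≢0 : NonZero (2 ℕ.^ E)
      2^E≢0 = ℕ.m^n≢0 2 E
      2^k≢0 : NonZero (2 ℕ.^ k)
      2^k≢0 = ℕ.m^n≢0 2 k
      2^E+k≢0 : NonZero (2 ℕ.^ (E ℕ.+ k))
      2^E+k≢0 = ℕ.m^n≢0 2 (E ℕ.+ k)
      2^E*2^k≢0 : NonZero (2 ℕ.^ E ℕ.* 2 ℕ.^ k)
      2^E*2^k≢0 = ℕ.m*n≢0 (2 ℕ.^ E) (2 ℕ.^ k)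

  x-dyadic : ∀ t → x t ≡ dyadic (numerator t , exponent t)
  x-dyadic zero    = refl
  x-dyadic (suc t) = sym (trans
    (addDyadic-amount (proj₂ (descend create up down t (0 , t , proj₁ (trajectory t)))) _)
    (cong₂ _+_ (sym (x-dyadic t)) (cong (λ r → amount (proj₂ r))
      (trans (cong (λ S → descend create up down t (0 , t , S)) (trajectory-tree t))
             (descend-step 0 t (tree-height t))))))

-- The limit real and its three properties

p-ε<p : ∀ p {ε} → 0ℚ < ε → p - ε < p
p-ε<p p {ε} 0<ε = subst (p - ε <_) (+-identityʳ p) (+-monoʳ-< p (ℚ.neg-antimono-< 0<ε))

p<p+ε : ∀ p {ε} → 0ℚ < ε → p < p + ε
p<p+ε p {ε} 0<ε = subst (_< p + ε) (+-identityʳ p) (+-monoʳ-< p 0<ε)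

½^-decreasing : ∀ n → ½^ suc n < ½^ n
½^-decreasing n = subst (½^ suc n <_) (½^-double n) (p<p+ε (½^ suc n) (½^-positive (suc n)))

module _ (em : ExcludedMiddle 0ℓ) (x : ℕ → ℚ) {b : ℚ} (x≤b : ∀ t → x t ≤ b) where

  supremum : ℝ
  supremum = record
    { lower           = λ q → ∃ λ t → q < x t
    ; upper           = λ q → ∃ λ r → r < q × (∀ t → x t ≤ r)
    ; lower-inhabited = x 0 - 1ℚ , 0 , p-ε<p (x 0) 0<1
    ; upper-inhabited = b + 1ℚ , b , p<p+ε b 0<1 , x≤b
    ; lower-rounded   = λ q → mk⇔ (λ (t , q<x) → let r , q<r , r<x = <-dense q<x in r , q<r , t , r<x)
                                  (λ (r , q<r , t , r<x) → t , <-trans q<r r<x)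
    ; upper-rounded   = λ q → mk⇔ (λ (r , r<q , x≤r) → let m , r<m , m<q = <-dense r<q in m , m<q , r , r<m , x≤r)
                                  (λ (m , m<q , r , r<m , x≤r) → r , <-trans r<m m<q , x≤r)
    ; disjoint        = λ q ((t , q<x) , r , r<q , x≤r) → <-irrefl refl (<-trans r<q (<-≤-trans q<x (x≤r t)))
    ; located         = located
    }
    where
    0<1 : 0ℚ < 1ℚ
    0<1 = ℚ.positive⁻¹ 1ℚ
    located : ∀ q r → q < r → (∃ λ t → q < x t) ⊎ (∃ λ r′ → r′ < r × (∀ t → x t ≤ r′))
    located q r q<r with em {∃ λ t → q < x t}
    ... | yes found = inj₁ found
    ... | no none   = inj₂ (q , q<r , λ t → ≮⇒≥ λ q<x → none (t , q<x))

⊖-/ : ∀ a b d → (a ⊖ b) / suc d + (ℤ.+ b) / suc d ≡ (ℤ.+ a) / suc d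
⊖-/ a b d = trans (fromℚᵘ-+ (mkℚᵘ (a ⊖ b) d) (mkℚᵘ (ℤ.+ b) d))
  (fromℚᵘ-cong {x = mkℚᵘ (a ⊖ b) d ℚᵘ.+ mkℚᵘ (ℤ.+ b) d} {y = mkℚᵘ (ℤ.+ a) d} (*≡* (begin
  ((a ⊖ b) ℤ.* D ℤ.+ (ℤ.+ b) ℤ.* D) ℤ.* D    ≡⟨ cong (ℤ._* D) (ℤ.*-distribʳ-+ D (a ⊖ b) (ℤ.+ b)) ⟨
  ((a ⊖ b) ℤ.+ (ℤ.+ b)) ℤ.* D ℤ.* D          ≡⟨ cong (λ z → z ℤ.* D ℤ.* D) cancel ⟩
  (ℤ.+ a) ℤ.* D ℤ.* D                        ≡⟨ ℤ.*-assoc (ℤ.+ a) D D ⟩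
  (ℤ.+ a) ℤ.* (D ℤ.* D)                      ∎)))
  where
  open ≡-Reasoning
  D : ℤ.ℤ
  D = ℤ.+ suc d
  cancel : (a ⊖ b) ℤ.+ (ℤ.+ b) ≡ ℤ.+ a
  cancel = begin
    (a ⊖ b) ℤ.+ (ℤ.+ b)              ≡⟨ cong (ℤ._+ (ℤ.+ b)) (ℤ.m-n≡m⊖n a b) ⟨
    (ℤ.+ a) ℤ.- (ℤ.+ b) ℤ.+ (ℤ.+ b)  ≡⟨ ℤ.+-assoc (ℤ.+ a) (ℤ.- (ℤ.+ b)) (ℤ.+ b) ⟩
    (ℤ.+ a) ℤ.+ (ℤ.- (ℤ.+ b) ℤ.+ (ℤ.+ b))  ≡⟨ cong (λ z → (ℤ.+ a) ℤ.+ z) (ℤ.+-inverseˡ (ℤ.+ b)) ⟩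
    (ℤ.+ a) ℤ.+ ℤ.0ℤ                 ≡⟨ ℤ.+-identityʳ (ℤ.+ a) ⟩
    ℤ.+ a                            ∎

computable : ∀ {f} → Comp {ℕ} {ℕ} f → ComputableFun f
computable (c computes c⇓) = c , c⇓

compute : ∀ {f} → ComputableFun f → Comp {ℕ} {ℕ} f
compute (c , c⇓) = c computes c⇓

modulus⇒convergent : ∀ {f y q} → IsModulus f y (fromℚ q) → y ConvergesTo fromℚ q
modulus⇒convergent {f} {y} {q} modulus ε 0<ε = f n , λ m f≤m →
  ≤-<-trans (+-monoʳ-≤ (y m) (ℚ.neg-antimono-≤ 2^-n≤ε)) (proj₁ (modulus n m f≤m)) ,
  <-≤-trans (proj₂ (modulus n m f≤m)) (+-monoʳ-≤ (y m) 2^-n≤ε)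
  where
  n : ℕ
  n = proj₁ (archimedean 0<ε)
  2^-n≤ε : 2^- n ≤ ε
  2^-n≤ε = proj₂ (archimedean 0<ε)

module Limit
  (em : ExcludedMiddle 0ℓ)
  (conv : ℕ → ℕ → ℕ → Bool) (convᶜ : Comp {ℕ × ℕ × ℕ} λ (e , n , t) → conv e n t)
  (universal : ∀ {f} → ComputableFun f → ∃ λ e → Decides (conv e) f)
  where
  open Construction conv
  open Dynamics conv
  open Analysis conv
  open Computation conv convᶜ

  -- Besides regaining itself, the case m = 0 supplies the upper bound needed for the supremum, and
  -- arbitrary m yields convergence.
  regaining : ∀ m → ∃ λ r → m ℕ.≤ r × (∀ u → x u ≤ x r + ½^ suc r)
  regaining m with p , R , m≤R , live ← live-path em m =
    FirstVisit.r (first-visit live) , ℕ.≤-trans m≤R (FirstVisit.R≤r (first-visit live)) , regain live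

  limit : ℝ
  limit = supremum em x (proj₂ (proj₂ (regaining 0)))

  x-computable : ComputableSeq x
  x-computable = numerator , (λ _ → 0) , (λ t → 2 ℕ.^ exponent t ℕ.∸ 1) ,
    computable numeratorᶜ , computable (constᶜ 0) , computable ((2^ᶜ exponentᶜ) ∸ᶜ constᶜ 1) ,
    λ t → trans (x-dyadic t) (predecessor (numerator t) (2 ℕ.^ exponent t) {{ℕ.m^n≢0 2 (exponent t)}})
    where
    predecessor : ∀ n d .{{_ : NonZero d}} → (ℤ.+ n) / d ≡ (n ⊖ 0) / suc (d ℕ.∸ 1)
    predecessor n (suc d) = refl

  x-convergent : x ConvergesTo limit
  x-convergent ε 0<ε with n , 2^-n≤ε ← archimedean 0<ε with r , n≤r , x≤ ← regaining n =
    r , λ m r≤m → (m , p-ε<p (x m) 0<ε) , (x r + ½^ suc r , bound m r≤m , x≤)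
    where
    bound : ∀ m → r ℕ.≤ m → x r + ½^ suc r < x m + ε
    bound m r≤m = ≤-<-trans (+-monoˡ-≤ (½^ suc r) (x-mono r≤m)) (+-monoʳ-< (x m)
      (<-≤-trans (½^-decreasing r) (≤-trans (½^-antitone n≤r) (subst (_≤ ε) (sym (½^≡2^- n)) 2^-n≤ε))))

  limit-regainingly-approximable : RegaininglyApproximable limit
  limit-regainingly-approximable = x , x-computable , x-mono , x-convergent , often
    where
    often : InfinitelyMany (λ n → limit <ʳ x n + 2^- n)
    often m with r , m≤r , x≤ ← regaining m =
      r , m≤r , x r + ½^ suc r , +-monoʳ-< (x r) (subst (½^ suc r <_) (½^≡2^- r) (½^-decreasing r)) , x≤

  module _ {s : ℕ → ℕ} (s-computable : ComputableFun s) (s-mono : Monotonic₁ ℕ._<_ ℕ._<_ s) where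

    difference : ℕ → ℚ
    difference n = x (s (suc n)) - x (s n)

    -- The path and its settling stage are found classically, but they are finite data that can be
    -- built into a program; the search for a large recorded stage is then computable.
    s-modulus : ∃ λ f → ComputableFun f × IsModulus f difference (fromℚ 0ℚ)
    s-modulus with j , decides ← universal s-computable with p , _ , _ , live ← live-path em j
              with R , _ , settled ← settle em live = f , computable fᶜ , modulus
      where
      -- It vanishes when both thresholds are reached. `window` at m + 1 requires m + 3 and yields
      -- ½^(m + 1), strictly below 2^-m.
      gauge : ℕ × ℕ → ℕ
      gauge (m , t) = (3 ℕ.+ m ℕ.∸ stageOf (at p t)) ℕ.+ (R ℕ.∸ t)

      gaugeᶜ : Comp gauge
      gaugeᶜ = ((constᶜ 3 +ᶜ fstᶜ) ∸ᶜ (stageOfᶜ ∘ᶜ subᶜ p ∘ᶜ treeᶜ ∘ᶜ sndᶜ)) +ᶜ (constᶜ R ∸ᶜ sndᶜ)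

      gauge-vanishes : ∀ m → ∃ λ t → gauge (m , t) ≡ 0
      gauge-vanishes m with t , M≤t , M≤stage ← stage-unbounded settled em decides (3 ℕ.+ m ℕ.+ R) =
        t , cong₂ ℕ._+_ (ℕ.m≤n⇒m∸n≡0 (ℕ.≤-trans (ℕ.m≤m+n (3 ℕ.+ m) R) M≤stage))
                        (ℕ.m≤n⇒m∸n≡0 (ℕ.≤-trans (ℕ.m≤n+m R (3 ℕ.+ m)) M≤t))

      least-zero : ∀ m → ∃ λ t → gauge (m , t) ≡ 0 × (∀ i → i ℕ.< t → ∃ λ k → gauge (m , i) ≡ suc k)
      least-zero m = least (λ t → gauge (m , t)) (proj₁ (gauge-vanishes m)) (proj₂ (gauge-vanishes m))

      f : ℕ → ℕ
      f m = proj₁ (least-zero m)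

      fᶜ : Comp f
      fᶜ = leastᶜ gaugeᶜ gauge-vanishes

      f-stage : ∀ m → 3 ℕ.+ m ℕ.≤ stageOf (at p (f m))
      f-stage m = ℕ.m∸n≡0⇒m≤n (ℕ.m+n≡0⇒m≡0 _ (proj₁ (proj₂ (least-zero m))))

      f-settled : ∀ m → R ℕ.≤ f m
      f-settled m = ℕ.m∸n≡0⇒m≤n (ℕ.m+n≡0⇒n≡0 (3 ℕ.+ m ℕ.∸ stageOf (at p (f m))) (proj₁ (proj₂ (least-zero m))))

      modulus : IsModulus f difference (fromℚ 0ℚ)
      modulus m n f≤n = small , nonneg
        where
        f≤s : f m ℕ.≤ s n
        f≤s = ℕ.≤-trans f≤n (mono⇒inflationary s-mono n)
        stage : 3 ℕ.+ m ℕ.≤ stageOf (at p (s n))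
        stage = from-induction (λ t → 3 ℕ.+ m ℕ.≤ stageOf (at p t)) (f-stage m)
          (λ f≤t le → ℕ.≤-trans le (stage-grows settled (ℕ.≤-trans (f-settled m) f≤t))) f≤s
        bound : x (s (suc n)) ≤ x (s n) + ½^ suc m
        bound = window settled decides s-mono (ℕ.≤-trans (f-settled m) f≤s) stage
        small : difference n - 2^- m < 0ℚ
        small = ≤-<-trans
          (linear {y = ½^ suc m - 2^- m} bound (rearrange₂₁ (x (s n)) (x (s (suc n))) (½^ suc m) (2^- m)))
          (subst (½^ suc m - 2^- m <_) (+-inverseʳ (2^- m))
            (+-monoˡ-< (- (2^- m)) (subst (½^ suc m <_) (½^≡2^- m) (½^-decreasing m))))
        nonneg : 0ℚ < difference n + 2^- m
        nonneg = +-mono-≤-< (subst (_≤ difference n) (+-inverseʳ (x (s n)))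
          (+-monoˡ-≤ (- x (s n)) (x-mono (ℕ.<⇒≤ (s-mono (ℕ.n<1+n n)))))) (2^-positive m)

    difference-convergent : difference ConvergesComputablyTo fromℚ 0ℚ
    difference-convergent =
      modulus⇒convergent {y = difference} {q = 0ℚ} (proj₂ (proj₂ s-modulus)) , s-modulus

  limit-nearly-computable : NearlyComputable limit
  limit-nearly-computable = x , x-computable , x-convergent , λ s → difference-convergent

  no-computable-modulus : ∀ {f} → ComputableFun f → ¬ (∀ k u → x u < x (f k) + ½^ k)
  no-computable-modulus {f} f-computable f-modulus =
    refute (proj₂ (universal f-computable)) (proj₂ (proj₂ (proj₂ (live-path em (proj₁ (universal f-computable))))))
    where
    refute : ∀ {e p R} → Decides (conv e) f → Live p e R → ⊥
    refute decides live = overtaken (gap live decides)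
      where
      overtaken : ¬ (∃ λ k → ∃ λ t → ∃ λ u → f k ℕ.≤ t × x t + ½^ k ≤ x u)
      overtaken (k , t , u , f≤t , gap≤) =
        <-irrefl refl (<-≤-trans (f-modulus k u) (≤-trans (+-monoˡ-≤ (½^ k) (x-mono f≤t)) gap≤))

  -- Fast approximations y of the limit would give a computable modulus of x: search for t with y (k
  -- + 1) - 2^-(k + 1) ≤ x t. The search succeeds because the left side is below the limit, and the
  -- two errors add up to 2^-k.
  limit-not-computable : ¬ Computable limit
  limit-not-computable (y , (a , b , d , a-computable , b-computable , d-computable , y≡) , y-within) =
    no-computable-modulus (computable fᶜ) f-modulus
    where
    -- Cleared of denominators: lhs ≤ rhs iff y (k + 1) - 2^-(k + 1) ≤ x t.
    lhs rhs gauge : ℕ × ℕ → ℕ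
    lhs (k , t) = a (suc k) ℕ.* (2 ℕ.^ exponent t ℕ.* suc (d (suc k)) ℕ.* 2 ℕ.^ suc k)
    rhs (k , t) = ((numerator t ℕ.* suc (d (suc k)) ℕ.+ b (suc k) ℕ.* 2 ℕ.^ exponent t) ℕ.* 2 ℕ.^ suc k ℕ.+
                   1 ℕ.* (2 ℕ.^ exponent t ℕ.* suc (d (suc k)))) ℕ.* suc (d (suc k))
    gauge s = lhs s ℕ.∸ rhs s

    gaugeᶜ : Comp gauge
    gaugeᶜ =
      A *ᶜ (2^E *ᶜ D *ᶜ 2^K) ∸ᶜ
      ((numeratorᶜ ∘ᶜ sndᶜ *ᶜ D +ᶜ B *ᶜ 2^E) *ᶜ 2^K +ᶜ constᶜ 1 *ᶜ (2^E *ᶜ D)) *ᶜ D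
      where
      A : Comp {ℕ × ℕ} λ (k , _) → a (suc k)
      A = compute a-computable ∘ᶜ sucᶜ fstᶜ
      B : Comp {ℕ × ℕ} λ (k , _) → b (suc k)
      B = compute b-computable ∘ᶜ sucᶜ fstᶜ
      D : Comp {ℕ × ℕ} λ (k , _) → suc (d (suc k))
      D = sucᶜ (compute d-computable ∘ᶜ sucᶜ fstᶜ)
      2^E : Comp {ℕ × ℕ} λ (_ , t) → 2 ℕ.^ exponent t
      2^E = 2^ᶜ (exponentᶜ ∘ᶜ sndᶜ)
      2^K : Comp {ℕ × ℕ} λ (k , _) → 2 ℕ.^ suc k
      2^K = 2^ᶜ (sucᶜ fstᶜ)

    module _ (k t : ℕ) where
      open ≡-Reasoning
      E K D : ℕ
      E = 2 ℕ.^ exponent t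
      K = 2 ℕ.^ suc k
      D = suc (d (suc k))
      instance
        E≢0 : NonZero E
        E≢0 = ℕ.m^n≢0 2 (exponent t)
        K≢0 : NonZero K
        K≢0 = ℕ.m^n≢0 2 (suc k)
        ED≢0 : NonZero (E ℕ.* D)
        ED≢0 = ℕ.m*n≢0 E D
        EDK≢0 : NonZero (E ℕ.* D ℕ.* K)
        EDK≢0 = ℕ.m*n≢0 (E ℕ.* D) K

      -- The negative part of y (k + 1); adding it to both sides turns the comparison into one of
      -- natural numbers.
      β : ℚ
      β = (ℤ.+ b (suc k)) / D

      N : ℕ
      N = (numerator t ℕ.* D ℕ.+ b (suc k) ℕ.* E) ℕ.* K ℕ.+ 1 ℕ.* (E ℕ.* D)

      lhs-≡ : y (suc k) + β ≡ (ℤ.+ a (suc k)) / D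
      lhs-≡ = trans (cong (_+ β) (y≡ (suc k))) (⊖-/ (a (suc k)) (b (suc k)) (d (suc k)))

      rhs-≡ : x t + β + 2^- suc k ≡ (ℤ.+ N) / (E ℕ.* D ℕ.* K)
      rhs-≡ = begin
        x t + β + 2^- suc k
          ≡⟨ cong (λ q → q + β + 2^- suc k) (x-dyadic t) ⟩
        (ℤ.+ numerator t) / E + β + 2^- suc k
          ≡⟨ cong (_+ 2^- suc k) (/-add (numerator t) E (b (suc k)) D) ⟩
        (ℤ.+ (numerator t ℕ.* D ℕ.+ b (suc k) ℕ.* E)) / (E ℕ.* D) + 2^- suc k
          ≡⟨ /-add (numerator t ℕ.* D ℕ.+ b (suc k) ℕ.* E) (E ℕ.* D) 1 K ⟩
        (ℤ.+ N) / (E ℕ.* D ℕ.* K) ∎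

      gauge-zero⇒ : gauge (k , t) ≡ 0 → y (suc k) ≤ x t + 2^- suc k
      gauge-zero⇒ eq = linear (/-≤ (a (suc k)) D N (E ℕ.* D ℕ.* K) (ℕ.m∸n≡0⇒m≤n eq))
        (trans (cong (y (suc k) +_) (sym rhs-≡))
          (trans (rearrange₂₂ (y (suc k)) (x t) β (2^- suc k)) (cong (x t + 2^- suc k +_) lhs-≡)))

      gauge-zero⇐ : y (suc k) - 2^- suc k < x t → gauge (k , t) ≡ 0
      gauge-zero⇐ lt = ℕ.m≤n⇒m∸n≡0 (ℕ.<⇒≤ (/-<⁻¹ (a (suc k)) D N (E ℕ.* D ℕ.* K)
        (subst₂ _<_ (trans (rearrange₂₃ (y (suc k)) β (2^- suc k)) lhs-≡)
                    (trans (sym (+-assoc (x t) β (2^- suc k))) rhs-≡)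
          (+-monoˡ-< (β + 2^- suc k) lt))))

    gauge-vanishes : ∀ k → ∃ λ t → gauge (k , t) ≡ 0
    gauge-vanishes k with t , lt ← proj₁ (y-within (suc k)) = t , gauge-zero⇐ k t lt

    least-zero : ∀ k → ∃ λ t → gauge (k , t) ≡ 0 × (∀ i → i ℕ.< t → ∃ λ n → gauge (k , i) ≡ suc n)
    least-zero k = least (λ t → gauge (k , t)) (proj₁ (gauge-vanishes k)) (proj₂ (gauge-vanishes k))

    f : ℕ → ℕ
    f k = proj₁ (least-zero k)

    fᶜ : Comp f
    fᶜ = leastᶜ gaugeᶜ gauge-vanishes

    f-modulus : ∀ k u → x u < x (f k) + ½^ k
    f-modulus k u = ≤-<-trans (x≤r u) (<-≤-trans r<y+2^- (≤-trans
      (+-monoˡ-≤ (2^- suc k) f-reaches) (≤-reflexive (begin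
      x (f k) + 2^- suc k + 2^- suc k    ≡⟨ +-assoc (x (f k)) (2^- suc k) (2^- suc k) ⟩
      x (f k) + (2^- suc k + 2^- suc k)  ≡⟨ cong (x (f k) +_) (2^-double k) ⟩
      x (f k) + 2^- k                    ≡⟨ cong (x (f k) +_) (½^≡2^- k) ⟨
      x (f k) + ½^ k                     ∎))))
      where
      open ≡-Reasoning
      r : ℚ
      r = proj₁ (proj₂ (y-within (suc k)))
      r<y+2^- : r < y (suc k) + 2^- suc k
      r<y+2^- = proj₁ (proj₂ (proj₂ (y-within (suc k))))
      x≤r : ∀ t → x t ≤ r
      x≤r = proj₂ (proj₂ (proj₂ (y-within (suc k))))
      f-reaches : y (suc k) ≤ x (f k) + 2^- suc k
      f-reaches = gauge-zero⇒ k (f k) (proj₁ (proj₂ (least-zero k)))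

mainTheorem2 : ExcludedMiddle 0ℓ → ∃ λ (x : ℝ) → RegaininglyApproximable x × NearlyComputable x × ¬ Computable x
mainTheorem2 em = limit , limit-regainingly-approximable , limit-nearly-computable , limit-not-computable
  where open Limit em converges convergesᶜ universal
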